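{- For every $n>0$, the $F$-triangle $F_n(x,y)$ associated with the Hochschild lattice $\mathrm{Hoch}(n)$ satisfies $$F_n(x,y)=\sum_{u\in\mathrm{Tri}(n)}x^{\,n-|\mathrm{Can}(u)|}(x+1)^{|\mathrm{Can}(u)|-\mathrm{neg}(u)}(y+1)^{\mathrm{neg}(u)}.$$
   Context: Hochschild lattice. For $n\geq 1$, a triword of length $n$ is a tuple $u=(u_1,\ldots,u_n)$ such that (T1) $u_i\in\{0,1,2\}$ for all $i$; (T2) $u_1\neq 2$; (T3) if $u_i=0$, then $u_j\neq 1$ for all $j>i$. Let $\mathrm{Tri}(n)$ be the set of all triwords of length $n$. The Hochschild lattice is $\mathrm{Hoch}(n)=(\mathrm{Tri}(n),\leq)$ where $\leq$ is the componentwise order. It is known to be a semidistributive lattice: the join is the componentwise maximum, and the meet is obtained by taking the componentwise minimum and then replacing by $0$ every entry $1$ that has an entry $0$ somewhere to its left. Labels, canonical join representations, core label order. Let $L$ be a finite semidistributive lattice. For a cover relation $a\lessdot b$ put $\lambda(a,b)=\min\{c\in L\mid a\vee c=b\}$; this minimum exists and is join irreducible. The canonical join representation of $a\in L$ is $\mathrm{Can}(a)=\{\lambda(b,a)\mid b\lessdot a\}$ (equivalently, the antichain with join $a$ that refines every subset with join $a$). The nucleus of $a$ is $a_\downarrow=a\wedge\bigwedge_{b\lessdot a}b$. The core label set of $a$ is $\Psi(a)=\{\lambda(b,b')\mid a_\downarrow\leq b\lessdot b'\leq a\}$. The map $a\mapsto\Psi(a)$ is injective. The core label order $\mathrm{CLO}(L)$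 is the poset $(L,\sqsubseteq)$ where $a\sqsubseteq b$ if and only if $\Psi(a)\subseteq\Psi(b)$. $F$-triangle. The poset $\mathrm{CLO}(\mathrm{Hoch}(n))$ is graded with least element $(0,\ldots,0)$; let $\mathrm{rk}$ be its rank function (so $\mathrm{rk}(0,\ldots,0)=0$) and $\mu_n$ its Möbius function (with $\mu_n(u,v)=0$ if $u\not\sqsubseteq v$). Define $$M_n(x,y)=\sum_{u,v\in\mathrm{Tri}(n)}\mu_n(u,v)\,x^{\mathrm{rk}(u)}y^{\mathrm{rk}(v)},\qquad F_n(x,y)=y^n M_n\left(\frac{y+1}{y-x},\frac{y-x}{y}\right).$$ Atoms. Let $\mathrm{Atom}(n)$ be the set of atoms of $\mathrm{Hoch}(n)$, i.e. of elements covering $(0,\ldots,0)$. Explicitly, these are $(1,0,\ldots,0)$ and, for $2\leq i\leq n$, the tuple with a $2$ in position $i$ and zeros elsewhere. For $u\in\mathrm{Tri}(n)$ let $\mathrm{neg}(u)=|\mathrm{Can}(u)\cap\mathrm{Atom}(n)|$, where $\mathrm{Can}(u)$ is taken in $\mathrm{Hoch}(n)$. -}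

module Defs where

open import Algebra.Bundles using (CommutativeRing)
open import Algebra.Definitions using (Invertible)
import Algebra.Construct.NaturalChoice.Max as Max
import Algebra.Construct.NaturalChoice.Min as Min
import Algebra.Properties.Semiring.Exp as Exp
import Algebra.Properties.Semiring.Mult as Mult
open import Data.Bool.Base using (if_then_else_)
open import Data.Fin.Base as Fin using (Fin; toℕ)
import Data.Fin.Induction as Fin
open import Data.Fin.Patterns using (0F; 1F; 2F)
import Data.Fin.Properties as Fin
open import Data.Integer.Base as ℤ using (ℤ; +_; -[1+_]; 0ℤ; 1ℤ)
open import Data.Irrelevant using ([_])
open import Data.List.Base
  using (List; []; _∷_; map; foldr; filter; length; allFin; cartesianProductWith)
open import Data.List.Extrema.Nat using (max)
open import Data.List.Membership.Propositional using (_∈_; lose; find)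
open import Data.List.Membership.Propositional.Properties
  using (∈-filter⁺; ∈-filter⁻; ∈-allFin; ∈-cartesianProductWith⁺)
open import Data.List.Properties using (map-cong)
import Data.List.Relation.Unary.All as All
import Data.List.Relation.Unary.All.Properties as All
open import Data.List.Relation.Unary.AllPairs using ([]; _∷_)
import Data.List.Relation.Unary.Any as Any
open import Data.List.Relation.Unary.Any using (here; there)
open import Data.List.Relation.Unary.Unique.Propositional using (Unique)
import Data.List.Relation.Unary.Unique.Propositional.Properties as Unique
open import Data.Nat.Base as ℕ using (ℕ; suc; _∸_)
import Data.Nat.Induction as ℕ
import Data.Nat.Properties as ℕ
open import Data.Product.Base using (∃; ∃-syntax; _×_; _,_; proj₁; proj₂)
open import Data.Refinement using (Refinement-syntax; value; proof; _,_)
open import Data.Sum.Base using (inj₁; inj₂)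
open import Data.Vec.Base as Vec using (Vec; []; _∷_; lookup; zipWith; tabulate; replicate)
import Data.Vec.Properties as Vec
open import Function.Base using (_∘_; flip; _on_)
open import Induction.WellFounded using (WellFounded; WfRec; module All; module FixPoint; module Subrelation)
open import Level using (Level; 0ℓ)
open import Relation.Binary.Core using (Rel)
import Relation.Binary.Construct.On as On
open import Relation.Binary.Definitions using (Transitive; Irreflexive; Antisymmetric)
  renaming (Decidable to Decidable₂)
open import Relation.Binary.Lattice.Structures using (IsLattice)
open import Relation.Binary.PropositionalEquality
  using (_≡_; _≢_; refl; sym; trans; cong; subst; isEquivalence)
open import Relation.Binary.Structures using (IsDecPartialOrder)
open import Relation.Nullary using (¬_; Dec; yes; no; contradiction; does; recompute)
open import Relation.Nullary.Decidable using (_×-dec_; _→-dec_; ¬?; map′; from-yes; decidable-stable)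
open import Relation.Unary using (Pred; Decidable; _⊆_; _∩_)
open import Relation.Unary.Properties using (_∩?_)

------------------------------------------------------------------------
-- Finite types

record Finite (A : Set) : Set where
  field
    elems    : List A
    complete : ∀ x → x ∈ elems
    unique   : Unique elems

  module _ {P : Pred A 0ℓ} (P? : Decidable P) where

    ∃? : Dec (∃ P)
    ∃? = map′ (λ e → let x , _ , px = find e in x , px)
              (λ (x , px) → lose (complete x) px)
              (Any.any? P? elems)

    ∀? : Dec (∀ x → P x)
    ∀? = map′ (λ ps x → All.lookup ps (complete x)) (λ f → All.universal f elems)
              (All.all? P? elems)

    card : ℕ
    card = length (filter P? elems)

  sumℤ : (A → ℤ) → ℤ
  sumℤ f = foldr ℤ._+_ 0ℤ (map f elems)

length-filter-≤ : {A : Set} {P Q : Pred A 0ℓ} (P? : Decidable P) (Q? : Decidable Q) →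
  P ⊆ Q → ∀ xs → length (filter P? xs) ℕ.≤ length (filter Q? xs)
length-filter-≤ P? Q? P⊆Q [] = ℕ.z≤n
length-filter-≤ P? Q? P⊆Q (x ∷ xs) with P? x | Q? x
... | yes p | yes q = ℕ.s≤s (length-filter-≤ P? Q? P⊆Q xs)
... | yes p | no ¬q = contradiction (P⊆Q p) ¬q
... | no ¬p | yes q = ℕ.m≤n⇒m≤1+n (length-filter-≤ P? Q? P⊆Q xs)
... | no ¬p | no ¬q = length-filter-≤ P? Q? P⊆Q xs

length-filter-< : {A : Set} {P Q : Pred A 0ℓ} (P? : Decidable P) (Q? : Decidable Q) →
  P ⊆ Q → ∀ {x xs} → x ∈ xs → ¬ P x → Q x →
  length (filter P? xs) ℕ.< length (filter Q? xs)
length-filter-< P? Q? P⊆Q {x} {_ ∷ xs} (here refl) ¬px qx with P? x | Q? x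
... | yes p | _     = contradiction p ¬px
... | no  _ | yes _ = ℕ.s≤s (length-filter-≤ P? Q? P⊆Q xs)
... | no  _ | no ¬q = contradiction qx ¬q
length-filter-< P? Q? P⊆Q {x} {y ∷ xs} (there x∈xs) ¬px qx with P? y | Q? y
... | yes p | yes q = ℕ.s≤s (length-filter-< P? Q? P⊆Q x∈xs ¬px qx)
... | yes p | no ¬q = contradiction (P⊆Q p) ¬q
... | no ¬p | yes q = ℕ.m≤n⇒m≤1+n (length-filter-< P? Q? P⊆Q x∈xs ¬px qx)
... | no ¬p | no ¬q = length-filter-< P? Q? P⊆Q x∈xs ¬px qx

finite-wellFounded : {A : Set} → Finite A → {_<_ : Rel A 0ℓ} → Decidable₂ _<_ →
  Transitive _<_ → Irreflexive _≡_ _<_ → WellFounded _<_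
finite-wellFounded fin {_<_} _<?_ tr irr =
  Subrelation.wellFounded {_<₂_ = ℕ._<_ on below} below-mono (On.wellFounded below ℕ.<-wellFounded)
  where
  open Finite fin
  below : _ → ℕ
  below x = card (_<? x)
  below-mono : ∀ {x y} → x < y → below x ℕ.< below y
  below-mono {x} {y} x<y =
    length-filter-< (_<? x) (_<? y) (λ z<x → tr z<x x<y) (complete x) (irr refl) x<y

byDec : ∀ {a b} {P : Set a} {B : Set b} → Dec P → (P → B) → B → B
byDec (yes p) f d = f p
byDec (no ¬p) f d = d

byDec-cong : ∀ {a b} {P : Set a} {B : Set b} (P? : Dec P) {f g : P → B} {d : B} →
  (∀ p → f p ≡ g p) → byDec P? f d ≡ byDec P? g d
byDec-cong (yes p) eq = eq p
byDec-cong (no ¬p) eq = refl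

------------------------------------------------------------------------
-- Finite posets

module FinitePoset {A : Set} (fin : Finite A) {_≤_ : Rel A 0ℓ}
  (isDecPartialOrder : IsDecPartialOrder _≡_ _≤_) where

  open Finite fin
  open IsDecPartialOrder isDecPartialOrder public
    using (_≟_; _≤?_; antisym) renaming (refl to ≤-refl; trans to ≤-trans; reflexive to ≤-reflexive)

  infix 4 _<_ _<?_ _⋖_ _⋖?_

  _<_ : Rel A 0ℓ
  x < y = x ≤ y × x ≢ y

  _<?_ : Decidable₂ _<_
  x <? y = x ≤? y ×-dec ¬? (x ≟ y)

  <-trans : Transitive _<_
  <-trans (p , _) (q , q≢) = ≤-trans p q , λ { refl → q≢ (antisym q p) }

  <-irrefl : Irreflexive _≡_ _<_
  <-irrefl eq (_ , neq) = neq eq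

  <-wellFounded : WellFounded _<_
  <-wellFounded = finite-wellFounded fin _<?_ <-trans <-irrefl

  >-wellFounded : WellFounded (flip _<_)
  >-wellFounded = finite-wellFounded fin (flip _<?_) (λ p q → <-trans q p) (<-irrefl ∘ sym)

  _⋖_ : Rel A 0ℓ
  x ⋖ y = x < y × (∀ z → ¬ (x < z × z < y))

  _⋖?_ : Decidable₂ _⋖_
  x ⋖? y = x <? y ×-dec ∀? (λ z → ¬? (x <? z ×-dec z <? y))

  lowerCover : ∀ {x a} → x < a → ∃[ p ] x ≤ p × p ⋖ a
  lowerCover {x} {a} = All.wfRec >-wellFounded 0ℓ (λ x → x < a → ∃[ p ] x ≤ p × p ⋖ a) step x
    where
    step : ∀ x → WfRec (flip _<_) (λ x → x < a → ∃[ p ] x ≤ p × p ⋖ a) x →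
           x < a → ∃[ p ] x ≤ p × p ⋖ a
    step x rec x<a with ∃? (λ z → x <? z ×-dec z <? a)
    ... | no ¬z = x , ≤-refl , x<a , λ z xz → ¬z (z , xz)
    ... | yes (z , x<z , z<a) with rec x<z z<a
    ...   | p , z≤p , p⋖a = p , ≤-trans (proj₁ x<z) z≤p , p⋖a

  -- The length of a longest chain with top element v.  In a graded poset with
  -- a least element this is the rank function.

  rank-step : ∀ v → WfRec _<_ (λ _ → ℕ) v → ℕ
  rank-step v rec = max 0 (map (λ w → byDec (w <? v) (λ w<v → suc (rec w<v)) 0) elems)

  rank : A → ℕ
  rank = All.wfRec <-wellFounded 0ℓ (λ _ → ℕ) rank-step

  rank-unfold : ∀ v → rank v ≡ max 0 (map (λ w → byDec (w <? v) (λ _ → suc (rank w)) 0) elems)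
  rank-unfold v = FixPoint.unfold-wfRec <-wellFounded (λ _ → ℕ) rank-step
    (λ v eq → cong (max 0)
      (map-cong (λ w → byDec-cong (w <? v) (λ w<v → cong suc (eq w<v))) elems))
    {v}

  μ-step : A → ∀ v → WfRec _<_ (λ _ → ℤ) v → ℤ
  μ-step u v rec =
    if does (u ≟ v) then 1ℤ else
    if does (u ≤? v) then ℤ.- sumℤ (λ w → byDec (u ≤? w ×-dec w <? v) (λ (_ , w<v) → rec w<v) 0ℤ)
    else 0ℤ

  μ : A → A → ℤ
  μ u = All.wfRec <-wellFounded 0ℓ (λ _ → ℤ) (μ-step u)

  μ-unfold : ∀ u v → μ u v ≡ μ-step u v (λ {w} _ → μ u w)
  μ-unfold u v = FixPoint.unfold-wfRec <-wellFounded (λ _ → ℤ) (μ-step u)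
    (λ v eq → cong (λ s → if does (u ≟ v) then 1ℤ else if does (u ≤? v) then ℤ.- s else 0ℤ)
      (cong (foldr ℤ._+_ 0ℤ)
        (map-cong (λ w → byDec-cong (u ≤? w ×-dec w <? v) (λ (_ , w<v) → eq w<v)) elems)))
    {v}

  μ-diagonal : ∀ u → μ u u ≡ 1ℤ
  μ-diagonal u rewrite μ-unfold u u with u ≟ u
  ... | yes _ = refl
  ... | no u≢u = contradiction refl u≢u

  μ-< : ∀ {u v} → u < v →
    μ u v ≡ ℤ.- sumℤ (λ w → byDec (u ≤? w ×-dec w <? v) (λ _ → μ u w) 0ℤ)
  μ-< {u} {v} (u≤v , u≢v) rewrite μ-unfold u v with u ≟ v | u ≤? v
  ... | yes u≡v | _      = contradiction u≡v u≢v
  ... | no _    | yes _  = refl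
  ... | no _    | no u≰v = contradiction u≤v u≰v

  μ-≰ : ∀ {u v} → ¬ u ≤ v → μ u v ≡ 0ℤ
  μ-≰ {u} {v} u≰v rewrite μ-unfold u v with u ≟ v | u ≤? v
  ... | yes u≡v | _       = contradiction (≤-reflexive u≡v) u≰v
  ... | no _    | yes u≤v = contradiction u≤v u≰v
  ... | no _    | no _    = refl

------------------------------------------------------------------------
-- Labels, canonical join representations and the core label order.  Of
-- semidistributivity only the join half is needed: it makes the minimum
-- defining a label exist.

JoinSemidistributive : {A : Set} (_∨_ _∧_ : A → A → A) → Set
JoinSemidistributive _∨_ _∧_ = ∀ a c d → a ∨ c ≡ a ∨ d → a ∨ (c ∧ d) ≡ a ∨ c

module CoreLabels {A : Set} (fin : Finite A)
  {_≤_ : Rel A 0ℓ} {_∨_ _∧_ : A → A → A}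
  (isDecPartialOrder : IsDecPartialOrder _≡_ _≤_)
  (isLattice : IsLattice _≡_ _≤_ _∨_ _∧_)
  (∨-semidistrib : JoinSemidistributive _∨_ _∧_) where

  open Finite fin
  open FinitePoset fin isDecPartialOrder
  open IsLattice isLattice using (x≤x∨y; y≤x∨y; ∨-least; x∧y≤x; x∧y≤y; ∧-greatest)

  -- λ(a,b) = c.
  IsLabel : A → A → Pred A 0ℓ
  IsLabel a b c = a ∨ c ≡ b × (∀ d → a ∨ d ≡ b → c ≤ d)

  isLabel? : ∀ a b → Decidable (IsLabel a b)
  isLabel? a b c = (a ∨ c) ≟ b ×-dec ∀? (λ d → (a ∨ d) ≟ b →-dec c ≤? d)

  label-exists : ∀ {a b} → a ⋖ b → ∃ (IsLabel a b)
  label-exists {a} {b} ((a≤b , _) , _) =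
    foldr _∧_ b cs , joins cs (λ c∈ → proj₂ (∈-filter⁻ sol? {xs = elems} c∈)) ,
    λ d eq → lower cs (∈-filter⁺ sol? (complete d) eq)
    where
    sol? : Decidable (λ c → a ∨ c ≡ b)
    sol? c = (a ∨ c) ≟ b
    cs = filter sol? elems
    a∨b≡b : a ∨ b ≡ b
    a∨b≡b = antisym (∨-least a≤b ≤-refl) (y≤x∨y a b)
    joins : ∀ xs → (∀ {c} → c ∈ xs → a ∨ c ≡ b) → a ∨ foldr _∧_ b xs ≡ b
    joins [] _ = a∨b≡b
    joins (x ∷ xs) h =
      trans (∨-semidistrib a x _ (trans (h (here refl)) (sym (joins xs (h ∘ there))))) (h (here refl))
    lower : ∀ xs {d} → d ∈ xs → foldr _∧_ b xs ≤ d
    lower (x ∷ xs) (here refl) = x∧y≤x x _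
    lower (x ∷ xs) (there d∈xs) = ≤-trans (x∧y≤y x _) (lower xs d∈xs)

  Can : A → Pred A 0ℓ
  Can a c = ∃[ b ] b ⋖ a × IsLabel b a c

  Can? : ∀ a → Decidable (Can a)
  Can? a c = ∃? (λ b → b ⋖? a ×-dec isLabel? b a c)

  nucleus : A → A
  nucleus a = foldr _∧_ a (filter (_⋖? a) elems)

  Ψ : A → Pred A 0ℓ
  Ψ a c = ∃[ b ] ∃[ b′ ] nucleus a ≤ b × b ⋖ b′ × b′ ≤ a × IsLabel b b′ c

  Ψ? : ∀ a → Decidable (Ψ a)
  Ψ? a c = ∃? λ b → ∃? λ b′ → nucleus a ≤? b ×-dec b ⋖? b′ ×-dec b′ ≤? a ×-dec isLabel? b b′ c

  infix 4 _⊑_ _⊑?_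

  _⊑_ : Rel A 0ℓ
  a ⊑ b = ∀ c → Ψ a c → Ψ b c

  _⊑?_ : Decidable₂ _⊑_
  a ⊑? b = ∀? (λ c → Ψ? a c →-dec Ψ? b c)

  ⊑⇒≤ : ∀ {a b} → a ⊑ b → a ≤ b
  ⊑⇒≤ {a} {b} a⊑b = decidable-stable (a ≤? b) λ a≰b →
    let p , a∧b≤p , p⋖a = lowerCover (x∧y≤x a b , λ eq → a≰b (subst (_≤ b) eq (x∧y≤y a b)))
        c , lab@(p∨c≡a , _) = label-exists p⋖a
        q , q′ , _ , _ , q′≤b , q∨c≡q′ , _ =
          a⊑b c (p , a , nucleus-≤ p⋖a , p⋖a , ≤-refl , lab)
        c≤a = subst (c ≤_) p∨c≡a (y≤x∨y p c)
        c≤b = ≤-trans (subst (c ≤_) q∨c≡q′ (y≤x∨y q c)) q′≤b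
        c≤p = ≤-trans (∧-greatest c≤a c≤b) a∧b≤p
        (p≤a , p≢a) , _ = p⋖a
    in p≢a (antisym p≤a (subst (_≤ p) p∨c≡a (∨-least ≤-refl c≤p)))
    where
    lower : ∀ xs {p} → p ∈ xs → foldr _∧_ a xs ≤ p
    lower (x ∷ xs) (here refl) = x∧y≤x x _
    lower (x ∷ xs) (there p∈xs) = ≤-trans (x∧y≤y x _) (lower xs p∈xs)
    nucleus-≤ : ∀ {p} → p ⋖ a → nucleus a ≤ p
    nucleus-≤ {p} p⋖a = lower _ (∈-filter⁺ (_⋖? a) (complete p) p⋖a)

  ⊑-isDecPartialOrder : IsDecPartialOrder _≡_ _⊑_
  ⊑-isDecPartialOrder = record
    { isPartialOrder = record
      { isPreorder = record
        { isEquivalence = isEquivalence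
        ; reflexive     = λ { refl _ p → p }
        ; trans         = λ p q c → q c ∘ p c
        }
      ; antisym = λ p q → antisym (⊑⇒≤ p) (⊑⇒≤ q)
      }
    ; _≟_  = _≟_
    ; _≤?_ = _⊑?_
    }

------------------------------------------------------------------------
-- Triwords.  Positions are counted from 0, so the first letter is the one at
-- the index i with toℕ i ≡ 0.

Word : ℕ → Set
Word n = Vec (Fin 3) n

IsTriword : ∀ {n} → Pred (Word n) 0ℓ
IsTriword u =
  (∀ i → toℕ i ≡ 0 → lookup u i ≢ 2F) ×
  (∀ i → lookup u i ≡ 0F → ∀ j → i Fin.< j → lookup u j ≢ 1F)

isTriword? : ∀ {n} → Decidable (IsTriword {n})
isTriword? u =
  Fin.all? (λ i → toℕ i ℕ.≟ 0 →-dec ¬? (lookup u i Fin.≟ 2F)) ×-dec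
  Fin.all? (λ i → lookup u i Fin.≟ 0F →-dec
    Fin.all? (λ j → i Fin.<? j →-dec ¬? (lookup u j Fin.≟ 1F)))

Tri : ℕ → Set
Tri n = [ u ∈ Word n ∣ IsTriword u ]

isTriword : ∀ {n} (u : Tri n) → IsTriword (value u)
isTriword (u , [ p ]) = recompute (isTriword? u) p

value-injective : ∀ {n} {u v : Tri n} → value u ≡ value v → u ≡ v
value-injective refl = refl

words : ∀ n → List (Word n)
words 0       = [] ∷ []
words (suc n) = cartesianProductWith _∷_ (allFin 3) (words n)

words-complete : ∀ {n} (u : Word n) → u ∈ words n
words-complete []      = here refl
words-complete (x ∷ u) = ∈-cartesianProductWith⁺ _∷_ (∈-allFin x) (words-complete u)

words-unique : ∀ n → Unique (words n)
words-unique 0       = All.[] ∷ []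
words-unique (suc n) =
  Unique.cartesianProductWith⁺ _∷_ (λ { refl → refl , refl }) (Unique.allFin⁺ 3) (words-unique n)

triwordsIn : ∀ {n} → List (Word n) → List (Tri n)
triwordsIn []       = []
triwordsIn (u ∷ us) = byDec (isTriword? u) (λ p → (u , [ p ]) ∷ triwordsIn us) (triwordsIn us)

∈-triwordsIn⁺ : ∀ {n} {us : List (Word n)} (u : Tri n) → value u ∈ us → u ∈ triwordsIn us
∈-triwordsIn⁺ {us = w ∷ us} u (here eq) with isTriword? w
... | yes _ = here (value-injective eq)
... | no ¬p = contradiction (subst IsTriword eq (isTriword u)) ¬p
∈-triwordsIn⁺ {us = w ∷ us} u (there u∈) with isTriword? w
... | yes _ = there (∈-triwordsIn⁺ u u∈)
... | no _  = ∈-triwordsIn⁺ u u∈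

∈-triwordsIn⁻ : ∀ {n} {us : List (Word n)} {u : Tri n} → u ∈ triwordsIn us → value u ∈ us
∈-triwordsIn⁻ {us = w ∷ us} u∈ with isTriword? w
∈-triwordsIn⁻ {us = w ∷ us} (here refl) | yes _ = here refl
∈-triwordsIn⁻ {us = w ∷ us} (there u∈)  | yes _ = there (∈-triwordsIn⁻ u∈)
∈-triwordsIn⁻ {us = w ∷ us} u∈          | no _  = there (∈-triwordsIn⁻ u∈)

triwordsIn-unique : ∀ {n} {us : List (Word n)} → Unique us → Unique (triwordsIn us)
triwordsIn-unique [] = []
triwordsIn-unique {us = w ∷ us} (w∉us ∷ us!) with isTriword? w
... | yes _ = All.tabulate (λ u∈ eq → All.lookup w∉us (∈-triwordsIn⁻ u∈) (cong value eq))
              ∷ triwordsIn-unique us!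
... | no _  = triwordsIn-unique us!

Tri-finite : ∀ n → Finite (Tri n)
Tri-finite n = record
  { elems    = triwordsIn (words n)
  ; complete = λ u → ∈-triwordsIn⁺ u (words-complete (value u))
  ; unique   = triwordsIn-unique (words-unique n)
  }

------------------------------------------------------------------------
-- The Hochschild lattice

open Max (Fin.≤-totalOrder 3) using (_⊔_; ⊔-sel; x≤x⊔y; x≤y⊔x; ⊔-lub)
open Min (Fin.≤-totalOrder 3) using (_⊓_; x⊓y≤x; x⊓y≤y; ⊓-glb)

infix 4 _≤ᵀ_

_≤ᵀ_ : ∀ {n} → Rel (Tri n) 0ℓ
u ≤ᵀ v = ∀ i → lookup (value u) i Fin.≤ lookup (value v) i

≤ᵀ-isDecPartialOrder : ∀ {n} → IsDecPartialOrder _≡_ (_≤ᵀ_ {n})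
≤ᵀ-isDecPartialOrder = record
  { isPartialOrder = record
    { isPreorder = record
      { isEquivalence = isEquivalence
      ; reflexive     = λ { refl i → Fin.≤-refl }
      ; trans         = λ p q i → Fin.≤-trans (p i) (q i)
      }
    ; antisym = λ p q → value-injective (lookup-ext λ i → Fin.≤-antisym (p i) (q i))
    }
  ; _≟_  = λ u v → map′ value-injective (cong value) (Vec.≡-dec Fin._≟_ (value u) (value v))
  ; _≤?_ = λ u v → Fin.all? (λ i → lookup (value u) i Fin.≤? lookup (value v) i)
  }
  where
  lookup-ext : ∀ {n} {u v : Word n} → (∀ i → lookup u i ≡ lookup v i) → u ≡ v
  lookup-ext {u = u} {v} eq =
    trans (sym (Vec.tabulate∘lookup u)) (trans (Vec.tabulate-cong eq) (Vec.tabulate∘lookup v))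

2≤⇒≡2 : ∀ {x : Fin 3} → Fin._≤_ {3} 2F x → x ≡ 2F
2≤⇒≡2 {0F} ()
2≤⇒≡2 {1F} (ℕ.s≤s ())
2≤⇒≡2 {2F} _ = refl

≤0⇒≡0 : ∀ {x : Fin 3} → Fin._≤_ {_} {3} x 0F → x ≡ 0F
≤0⇒≡0 {0F} _ = refl

joinWord : ∀ {n} → Word n → Word n → Word n
joinWord = zipWith _⊔_

joinWord-triword : ∀ {n} {u v : Word n} → IsTriword u → IsTriword v → IsTriword (joinWord u v)
joinWord-triword {u = u} {v} (u2 , u3) (v2 , v3) = t2 , t3
  where
  at : ∀ i → lookup (joinWord u v) i ≡ lookup u i ⊔ lookup v i
  at i = Vec.lookup-zipWith _⊔_ i u v
  ⊔≡0 : ∀ x y → x ⊔ y ≡ 0F → x ≡ 0F × y ≡ 0F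
  ⊔≡0 x y eq = ≤0⇒≡0 (subst (x Fin.≤_) eq (x≤x⊔y x y)) , ≤0⇒≡0 (subst (y Fin.≤_) eq (x≤y⊔x x y))
  t2 : ∀ i → toℕ i ≡ 0 → lookup (joinWord u v) i ≢ 2F
  t2 i i≡0 eq rewrite at i with ⊔-sel (lookup u i) (lookup v i)
  ... | inj₁ e = u2 i i≡0 (trans (sym e) eq)
  ... | inj₂ e = v2 i i≡0 (trans (sym e) eq)
  t3 : ∀ i → lookup (joinWord u v) i ≡ 0F → ∀ j → i Fin.< j → lookup (joinWord u v) j ≢ 1F
  t3 i eq0 j i<j eq1 rewrite at i | at j
    with ⊔≡0 (lookup u i) (lookup v i) eq0 | ⊔-sel (lookup u j) (lookup v j)
  ... | u0 , _ | inj₁ e = u3 i u0 j i<j (trans (sym e) eq1)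
  ... | _ , v0 | inj₂ e = v3 i v0 j i<j (trans (sym e) eq1)

BadOne : ∀ {n} → Word n → Pred (Fin n) 0ℓ
BadOne m i = lookup m i ≡ 1F × ∃[ j ] j Fin.< i × lookup m j ≡ 0F

badOne? : ∀ {n} (m : Word n) → Decidable (BadOne m)
badOne? m i = lookup m i Fin.≟ 1F ×-dec Fin.any? (λ j → j Fin.<? i ×-dec lookup m j Fin.≟ 0F)

zeroBadOnes : ∀ {n} → Word n → Word n
zeroBadOnes m = tabulate λ i → if does (badOne? m i) then 0F else lookup m i

meetWord : ∀ {n} → Word n → Word n → Word n
meetWord u v = zeroBadOnes (zipWith _⊓_ u v)

data ZeroBadOnesAt {n} (m : Word n) (i : Fin n) : Fin 3 → Set where
  kept   : ¬ BadOne m i → ZeroBadOnesAt m i (lookup m i)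
  zeroed : BadOne m i → ZeroBadOnesAt m i 0F

zeroBadOnes-at : ∀ {n} (m : Word n) i → ZeroBadOnesAt m i (lookup (zeroBadOnes m) i)
zeroBadOnes-at m i =
  subst (ZeroBadOnesAt m i)
    (sym (Vec.lookup∘tabulate (λ i → if does (badOne? m i) then 0F else lookup m i) i))
    (at (badOne? m i))
  where
  at : (bad? : Dec (BadOne m i)) → ZeroBadOnesAt m i (if does bad? then 0F else lookup m i)
  at (yes b) = zeroed b
  at (no ¬b) = kept ¬b

zeroBadOnes-≤ : ∀ {n} (m : Word n) i → lookup (zeroBadOnes m) i Fin.≤ lookup m i
zeroBadOnes-≤ m i with lookup (zeroBadOnes m) i | zeroBadOnes-at m i
... | _ | kept _   = Fin.≤-refl
... | _ | zeroed _ = ℕ.z≤n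

meetWord-≤ˡ : ∀ {n} (u v : Word n) i → lookup (meetWord u v) i Fin.≤ lookup u i
meetWord-≤ˡ u v i = Fin.≤-trans (zeroBadOnes-≤ (zipWith _⊓_ u v) i)
  (subst (Fin._≤ lookup u i) (sym (Vec.lookup-zipWith _⊓_ i u v)) (x⊓y≤x (lookup u i) (lookup v i)))

meetWord-≤ʳ : ∀ {n} (u v : Word n) i → lookup (meetWord u v) i Fin.≤ lookup v i
meetWord-≤ʳ u v i = Fin.≤-trans (zeroBadOnes-≤ (zipWith _⊓_ u v) i)
  (subst (Fin._≤ lookup v i) (sym (Vec.lookup-zipWith _⊓_ i u v)) (x⊓y≤y (lookup u i) (lookup v i)))

meetWord-triword : ∀ {n} {u v : Word n} → IsTriword u → IsTriword v → IsTriword (meetWord u v)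
meetWord-triword {u = u} {v} (u2 , _) _ = t2 , t3
  where
  m = zipWith _⊓_ u v
  t2 : ∀ i → toℕ i ≡ 0 → lookup (meetWord u v) i ≢ 2F
  t2 i i≡0 eq = u2 i i≡0 (2≤⇒≡2 (subst (Fin._≤ lookup u i) eq (meetWord-≤ˡ u v i)))
  t3 : ∀ i → lookup (meetWord u v) i ≡ 0F → ∀ j → i Fin.< j → lookup (meetWord u v) j ≢ 1F
  t3 i eq0 j i<j eq1
    with lookup (meetWord u v) i | zeroBadOnes-at m i | lookup (meetWord u v) j | zeroBadOnes-at m j
  ... | _ | kept _ | _ | kept ¬bad = ¬bad (eq1 , i , i<j , eq0)
  ... | _ | zeroed (_ , k , k<i , eq) | _ | kept ¬bad = ¬bad (eq1 , k , Fin.<-trans k<i i<j , eq)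
  t3 i eq0 j i<j () | _ | _ | _ | zeroed _

infixr 6 _∨ᵀ_
infixr 7 _∧ᵀ_

_∨ᵀ_ : ∀ {n} → Tri n → Tri n → Tri n
(u , [ p ]) ∨ᵀ (v , [ q ]) = joinWord u v , [ joinWord-triword {u = u} {v} p q ]

_∧ᵀ_ : ∀ {n} → Tri n → Tri n → Tri n
(u , [ p ]) ∧ᵀ (v , [ q ]) = meetWord u v , [ meetWord-triword {u = u} {v} p q ]

Hoch-isLattice : ∀ {n} → IsLattice _≡_ (_≤ᵀ_ {n}) _∨ᵀ_ _∧ᵀ_
Hoch-isLattice = record
  { isPartialOrder = IsDecPartialOrder.isPartialOrder ≤ᵀ-isDecPartialOrder
  ; supremum = λ u v →
      (λ i → subst (_ Fin.≤_) (sym (join-at u v i)) (x≤x⊔y (lookup (value u) i) (lookup (value v) i))) ,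
      (λ i → subst (_ Fin.≤_) (sym (join-at u v i)) (x≤y⊔x (lookup (value u) i) (lookup (value v) i))) ,
      (λ w u≤w v≤w i → subst (Fin._≤ _) (sym (join-at u v i)) (⊔-lub (u≤w i) (v≤w i)))
  ; infimum = λ u v →
      meetWord-≤ˡ (value u) (value v) , meetWord-≤ʳ (value u) (value v) , greatest u v
  }
  where
  join-at : ∀ {n} (u v : Tri n) i →
    lookup (value (u ∨ᵀ v)) i ≡ lookup (value u) i ⊔ lookup (value v) i
  join-at u v i = Vec.lookup-zipWith _⊔_ i (value u) (value v)
  ≤1∧≢1⇒≤0 : ∀ (x : Fin 3) → Fin._≤_ {_} {3} x 1F → x ≢ 1F → Fin._≤_ {_} {3} x 0F
  ≤1∧≢1⇒≤0 0F _ _ = ℕ.z≤n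
  ≤1∧≢1⇒≤0 1F _ x≢1 = contradiction refl x≢1
  ≤1∧≢1⇒≤0 2F (ℕ.s≤s ()) _
  greatest : ∀ {n} (u v w : Tri n) → w ≤ᵀ u → w ≤ᵀ v → w ≤ᵀ u ∧ᵀ v
  greatest u v w w≤u w≤v i = go (zeroBadOnes-at m i)
    where
    m = zipWith _⊓_ (value u) (value v)
    w≤m : ∀ i → lookup (value w) i Fin.≤ lookup m i
    w≤m i = subst (_ Fin.≤_) (sym (Vec.lookup-zipWith _⊓_ i (value u) (value v)))
      (⊓-glb (w≤u i) (w≤v i))
    go : ∀ {x} → ZeroBadOnesAt m i x → lookup (value w) i Fin.≤ x
    go (kept _) = w≤m i
    go (zeroed (eq1 , j , j<i , eq0)) =
      ≤1∧≢1⇒≤0 _ (subst (_ Fin.≤_) eq1 (w≤m i))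
        (proj₂ (isTriword w) j (≤0⇒≡0 (subst (_ Fin.≤_) eq0 (w≤m j))) i j<i)

Hoch-∨-semidistrib : ∀ {n} → JoinSemidistributive (_∨ᵀ_ {n}) _∧ᵀ_
Hoch-∨-semidistrib {n} a c d eq = ≤-antisym {a ∨ᵀ (c ∧ᵀ d)} {a ∨ᵀ c}
  (∨-least {a} {c ∧ᵀ d} {a ∨ᵀ c} (x≤x∨y a c)
    (≤-trans {c ∧ᵀ d} {c} {a ∨ᵀ c} (x∧y≤x c d) (y≤x∨y a c)))
  (∨-least {a} {c} {a ∨ᵀ (c ∧ᵀ d)} (x≤x∨y a (c ∧ᵀ d))
    (λ i → subst (_ Fin.≤_) (sym (Vec.lookup-zipWith _⊔_ i (value a) (value (c ∧ᵀ d))))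
             (go i (zeroBadOnes-at m i))))
  where
  open IsLattice (Hoch-isLattice {n}) using (x≤x∨y; y≤x∨y; ∨-least; x∧y≤x)
    renaming (antisym to ≤-antisym; trans to ≤-trans)
  m = zipWith _⊓_ (value c) (value d)
  m-at : ∀ i → lookup m i ≡ lookup (value c) i ⊓ lookup (value d) i
  m-at i = Vec.lookup-zipWith _⊓_ i (value c) (value d)
  eq-at : ∀ i → lookup (value a) i ⊔ lookup (value c) i ≡ lookup (value a) i ⊔ lookup (value d) i
  eq-at i = trans (sym (Vec.lookup-zipWith _⊔_ i (value a) (value c)))
    (trans (cong (λ w → lookup (value w) i) eq) (Vec.lookup-zipWith _⊔_ i (value a) (value d)))
  kept-case : ∀ (x y z : Fin 3) → x ⊔ y ≡ x ⊔ z → y Fin.≤ (x ⊔ (y ⊓ z))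
  kept-case = from-yes (Fin.all? λ x → Fin.all? λ y → Fin.all? λ z →
    (x ⊔ y) Fin.≟ (x ⊔ z) →-dec y Fin.≤? (x ⊔ (y ⊓ z)))
  zeroed-case : ∀ (x y z : Fin 3) → x ⊔ y ≡ x ⊔ z → y ⊓ z ≡ 1F → ¬ (y ≡ 1F × z ≡ 1F) →
    y Fin.≤ (x ⊔ 0F)
  zeroed-case = from-yes (Fin.all? λ x → Fin.all? λ y → Fin.all? λ z →
    (x ⊔ y) Fin.≟ (x ⊔ z) →-dec (y ⊓ z) Fin.≟ 1F →-dec ¬? (y Fin.≟ 1F ×-dec z Fin.≟ 1F) →-dec
    y Fin.≤? (x ⊔ 0F))
  ⊓≡0 : ∀ (y z : Fin 3) → y ⊓ z ≡ 0F → y ≢ 0F → z ≡ 0F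
  ⊓≡0 = from-yes (Fin.all? λ y → Fin.all? λ z →
    (y ⊓ z) Fin.≟ 0F →-dec ¬? (y Fin.≟ 0F) →-dec z Fin.≟ 0F)
  go : ∀ i {x} → ZeroBadOnesAt m i x → lookup (value c) i Fin.≤ (lookup (value a) i ⊔ x)
  go i (kept _) = subst (λ x → lookup (value c) i Fin.≤ (lookup (value a) i ⊔ x)) (sym (m-at i))
    (kept-case _ _ _ (eq-at i))
  go i (zeroed (eq1 , j , j<i , eq0)) =
    zeroed-case _ _ _ (eq-at i) (trans (sym (m-at i)) eq1) λ (c1 , d1) →
      proj₂ (isTriword d) j
        (⊓≡0 _ _ (trans (sym (m-at j)) eq0) λ c0 → proj₂ (isTriword c) j c0 i j<i c1) i j<i d1

module Hoch (n : ℕ) where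
  open FinitePoset (Tri-finite n) ≤ᵀ-isDecPartialOrder public
  open CoreLabels (Tri-finite n) ≤ᵀ-isDecPartialOrder Hoch-isLattice Hoch-∨-semidistrib public

module CLO (n : ℕ) = FinitePoset (Tri-finite n) (Hoch.⊑-isDecPartialOrder n)

zeroTriword : ∀ n → Tri n
zeroTriword n = replicate n 0F , [ t2 , t3 ]
  where
  t2 : ∀ i → toℕ i ≡ 0 → lookup (replicate n 0F) i ≢ 2F
  t2 i _ eq with () ← trans (sym (Vec.lookup-replicate i 0F)) eq
  t3 : ∀ i → lookup (replicate n 0F) i ≡ 0F → ∀ j → i Fin.< j → lookup (replicate n 0F) j ≢ 1F
  t3 _ _ j _ eq with () ← trans (sym (Vec.lookup-replicate j 0F)) eq

Atom : ∀ {n} → Pred (Tri n) 0ℓ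
Atom {n} u = Hoch._⋖_ n (zeroTriword n) u

atom? : ∀ {n} → Decidable (Atom {n})
atom? {n} u = Hoch._⋖?_ n (zeroTriword n) u

∣Can∣ : ∀ {n} → Tri n → ℕ
∣Can∣ {n} u = Finite.card (Tri-finite n) (Hoch.Can? n u)

neg : ∀ {n} → Tri n → ℕ
neg {n} u = Finite.card (Tri-finite n) (Hoch.Can? n u ∩? atom?)

------------------------------------------------------------------------
-- The F-triangle

module Triangle {c ℓ} (R : CommutativeRing c ℓ) where
  open CommutativeRing R
  open Exp semiring using (_^_) public
  open Mult semiring using () renaming (_×_ to _×ᴿ_)

  fromℤ : ℤ → Carrier
  fromℤ (+ k)    = k ×ᴿ 1#
  fromℤ -[1+ k ] = - (suc k ×ᴿ 1#)

  ∑Tri : ∀ n → (Tri n → Carrier) → Carrier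
  ∑Tri n f = foldr _+_ 0# (map f (Finite.elems (Tri-finite n)))

  M : ℕ → Carrier → Carrier → Carrier
  M n x y = ∑Tri n λ u → ∑Tri n λ v →
    fromℤ (CLO.μ n u v) * x ^ CLO.rank n u * y ^ CLO.rank n v

  -- The substitution into M needs y and y - x to be invertible.  The universal
  -- such ring is ℤ[x,y] localised at y and y - x, a subring of ℚ(x,y).
  F : ℕ → (x y : Carrier) → Invertible _≈_ 1# _*_ y → Invertible _≈_ 1# _*_ (y - x) → Carrier
  F n x y (y⁻¹ , _) ([y-x]⁻¹ , _) = y ^ n * M n ((y + 1#) * [y-x]⁻¹) ((y - x) * y⁻¹)

{-# OPTIONS --safe #-}

-- A triword is determined by the set A of the positions of its 2s and the position l of its last 1,
-- if it has one.  Its canonical joinands are the atoms with a single 2 at a position in A and the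
-- word 1…10…0 with last 1 at l; its core labels are the same atoms and the words 1…10…0 whose last
-- 1 is at a j ≥ l with only 2s in the positions l + 1, …, j.  So u ⊑ v means that the 2s of u are
-- 2s of v and that, if u has its last 1 at l, the letters of v are nonzero up to l and different
-- from 1 after l.  The rank is the number of canonical joinands.
--
-- The sums g(v) = ∑_u μ(u,v) q^rk(u) are the only solution of ∑_{v ⊑ w} g(v) = q^rk(w).  With
-- p = q − 1, the solution is p^∣A∣ if v has no 1, and p^∣A∣ (p − t) if its last 1 is directly
-- followed by t letters 2.  Summing g(v) r^rk(v) turns the left-hand side into
-- σⁿ + (n − 1) x (x + 1) σⁿ⁻² with σ = x + y + 1, which is also the right-hand side, as the words
-- with last 1 at l contribute according to the binomial theorem.

module Submission where

open import Defs
open import Algebra.Bundles using (CommutativeRing)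
open import Algebra.Definitions using (Invertible)
import Algebra.Construct.NaturalChoice.Max as Max
import Algebra.Properties.Group
import Algebra.Properties.Ring
import Algebra.Properties.Semiring.Mult as Mult
import Algebra.Solver.Ring.NaturalCoefficients.Default as Solver
open import Data.Bool.Base using (Bool; true; false; if_then_else_; _∧_)
open import Data.Bool.Properties using (∧-zeroʳ)
open import Data.Fin.Base as Fin using (Fin; zero; suc; toℕ)
open import Data.Fin.Patterns using (0F; 1F; 2F)
import Data.Fin.Properties as Fin
open import Data.Fin.Subset as Subset using (Subset; inside; outside; ∣_∣; _⊆_)
import Data.Fin.Subset.Properties as Subset
open import Data.Integer.Base as ℤ using (ℤ; +_; -[1+_]; 0ℤ)
import Data.Integer.Properties as ℤ
open import Data.Irrelevant using ([_])
open import Data.List.Base as List using (List; []; _∷_; foldr; filter; length; _++_)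
open import Data.List.Extrema.Nat as Extrema using (max)
open import Data.List.Membership.Propositional using (_∈_; lose)
open import Data.List.Membership.Propositional.Properties
  using (∈-filter⁺; ∈-filter⁻; ∈-map⁺; ∈-map⁻; ∈-++⁺ˡ; ∈-++⁺ʳ; ∈-++⁻)
open import Data.List.Membership.Propositional.Properties.WithK using (unique∧set⇒bag)
import Data.List.Properties as List
open import Data.List.Relation.Binary.BagAndSetEquality using (∼bag⇒↭)
open import Data.List.Relation.Binary.Permutation.Propositional as Perm using (_↭_)
open import Data.List.Relation.Binary.Permutation.Propositional.Properties using (↭-length)
import Data.List.Relation.Unary.All as All
import Data.List.Relation.Unary.All.Properties as All
open import Data.List.Relation.Unary.AllPairs using ([]; _∷_)
open import Data.List.Relation.Unary.Any using (here; there)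
import Data.List.Relation.Unary.Any.Properties as Any
open import Data.List.Relation.Unary.Unique.Propositional using (Unique)
import Data.List.Relation.Unary.Unique.Propositional.Properties as Unique
open import Data.Maybe.Base using (Maybe; just; nothing)
open import Data.Nat.Base as ℕ using (ℕ; zero; suc; z≤n; s≤s; _∸_; _>_)
import Data.Nat.Properties as ℕ
open import Data.Product.Base using (∃; ∃-syntax; _×_; _,_; proj₁; proj₂)
open import Data.Refinement using (value; _,_)
open import Data.Sum.Base using (_⊎_; inj₁; inj₂)
open import Data.Vec.Base as Vec using (Vec; []; _∷_; lookup; tabulate; _[_]≔_; here; there)
import Data.Vec.Properties as Vec
open import Function.Base using (_∘_; id)
open import Function.Bundles using (_⇔_; mk⇔; module Equivalence)
open import Induction.WellFounded using (module All)
open import Level using (0ℓ)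
open import Relation.Binary.Core using (Rel)
open import Relation.Binary.Definitions using (tri<; tri≈; tri>)
open import Relation.Binary.Lattice.Structures using (IsLattice)
open import Relation.Binary.PropositionalEquality as ≡
  using (_≡_; _≢_; refl; sym; trans; cong; subst; subst₂)
open import Relation.Binary.Structures using (IsDecPartialOrder)
open import Relation.Nullary using (¬_; Dec; yes; no; contradiction; does)
open import Relation.Nullary.Decidable
  using (_×-dec_; _→-dec_; ¬?; map′; from-yes; decidable-stable; dec-true; dec-false; does-⇔)
open import Relation.Unary using (Pred; Decidable)

-- The correction `p - t` measures how far a lower interval is from being Boolean. In a Boolean
-- interval the solution at `v` would be `p` to the power of the rank of `v`. A last 1 directly
-- followed by `t` letters 2 brings `t` core labels beyond the canonical joinands, because the last
-- 1 of a smaller word may sit on any of these 2s. The word 12 shows the effect: it has rank 2 but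
-- three atoms below it, namely 02, 10 and 11, so that `(1 + p)² = 1 + 3p + g` forces
-- `g = p (p - 1)`.
--
-- The closed form with its factor `n - 1` and its power of exponent `n - 2` has no uniform meaning
-- at `n = 1`. It is therefore replaced by a recurrence in the number of letters after the first,
-- which both sides satisfy with the same initial value.

open Max (Fin.≤-totalOrder 3) using (_⊔_)

-- Letters of triwords

infixl 8 _!_

_!_ : ∀ {n} → Tri n → Fin n → Fin 3
u ! i = lookup (value u) i

Tri-ext : ∀ {n} {u v : Tri n} → (∀ i → u ! i ≡ v ! i) → u ≡ v
Tri-ext {u = u} {v} eq = IsDecPartialOrder.antisym ≤ᵀ-isDecPartialOrder {u} {v}
  (λ i → Fin.≤-reflexive (eq i)) (λ i → Fin.≤-reflexive (sym (eq i)))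

head≢2 : ∀ {m} (u : Tri (suc m)) → u ! zero ≢ 2F
head≢2 u = proj₁ (isTriword u) zero refl

no-1-after-0 : ∀ {n} (u : Tri n) {i j} → i Fin.< j → u ! i ≡ 0F → u ! j ≢ 1F
no-1-after-0 u i<j u0 = proj₂ (isTriword u) _ u0 _ i<j

0≤ : ∀ {x y : Fin 3} → x ≡ 0F → x Fin.≤ y
0≤ refl = z≤n

<⇒0,1⊎2 : ∀ (x y : Fin 3) → x Fin.< y → (y ≡ 1F × x ≡ 0F) ⊎ (y ≡ 2F × x ≢ 2F)
<⇒0,1⊎2 0F 1F _ = inj₁ (refl , refl)
<⇒0,1⊎2 0F 2F _ = inj₂ (refl , λ ())
<⇒0,1⊎2 1F 1F (s≤s ())
<⇒0,1⊎2 1F 2F _ = inj₂ (refl , λ ())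
<⇒0,1⊎2 2F 1F (s≤s ())
<⇒0,1⊎2 2F 2F (s≤s (s≤s ()))

≢0⇒1≤ : ∀ {x : Fin 3} → x ≢ 0F → Fin._≤_ {3} 1F x
≢0⇒1≤ {0F} x≢0 = contradiction refl x≢0
≢0⇒1≤ {suc _} _ = s≤s z≤n

1≤⇒≢0 : ∀ {x : Fin 3} → Fin._≤_ {3} 1F x → x ≢ 0F
1≤⇒≢0 {suc _} _ ()

≢0,≢1⇒≡2 : ∀ {x : Fin 3} → x ≢ 0F → x ≢ 1F → x ≡ 2F
≢0,≢1⇒≡2 {0F} p q = contradiction refl p
≢0,≢1⇒≡2 {1F} p q = contradiction refl q
≢0,≢1⇒≡2 {2F} p q = refl

≢1,≢2⇒≡0 : ∀ {x : Fin 3} → x ≢ 1F → x ≢ 2F → x ≡ 0F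
≢1,≢2⇒≡0 {0F} p q = refl
≢1,≢2⇒≡0 {1F} p q = contradiction refl p
≢1,≢2⇒≡0 {2F} p q = contradiction refl q

≢0,≢2⇒≡1 : ∀ {x : Fin 3} → x ≢ 0F → x ≢ 2F → x ≡ 1F
≢0,≢2⇒≡1 {0F} p q = contradiction refl p
≢0,≢2⇒≡1 {1F} p q = refl
≢0,≢2⇒≡1 {2F} p q = contradiction refl q

≤1⇒≢2 : ∀ {x : Fin 3} → Fin._≤_ {_} {3} x 1F → x ≢ 2F
≤1⇒≢2 (s≤s ()) refl

≢2⇒≤1 : ∀ {x : Fin 3} → x ≢ 2F → Fin._≤_ {_} {3} x 1F
≢2⇒≤1 {0F} _ = z≤n
≢2⇒≤1 {1F} _ = s≤s z≤n
≢2⇒≤1 {2F} p = contradiction refl p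

⊔≡2 : ∀ (x y : Fin 3) → x ≢ 2F → x ⊔ y ≡ 2F → y ≡ 2F
⊔≡2 = from-yes (Fin.all? λ x → Fin.all? λ y →
  ¬? (x Fin.≟ 2F) →-dec (x ⊔ y) Fin.≟ 2F →-dec y Fin.≟ 2F)

0⊔≡1 : ∀ (x y : Fin 3) → x ≡ 0F → x ⊔ y ≡ 1F → y ≡ 1F
0⊔≡1 = from-yes (Fin.all? λ x → Fin.all? λ y →
  x Fin.≟ 0F →-dec (x ⊔ y) Fin.≟ 1F →-dec y Fin.≟ 1F)

⊔0≡1 : ∀ (x y : Fin 3) → y ≡ 0F → x ⊔ y ≡ 1F → x ≡ 1F
⊔0≡1 = from-yes (Fin.all? λ x → Fin.all? λ y →
  y Fin.≟ 0F →-dec (x ⊔ y) Fin.≟ 1F →-dec x Fin.≟ 1F)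

stepLetter : ℕ → ℕ → Fin 3
stepLetter k i = if does (i ℕ.<? k) then 1F else 0F

stepLetter-< : ∀ {k i} → i ℕ.< k → stepLetter k i ≡ 1F
stepLetter-< {k} {i} i<k = cong (if_then 1F else 0F) (dec-true (i ℕ.<? k) i<k)

stepLetter-≥ : ∀ {k i} → k ℕ.≤ i → stepLetter k i ≡ 0F
stepLetter-≥ {k} {i} k≤i = cong (if_then 1F else 0F) (dec-false (i ℕ.<? k) (ℕ.≤⇒≯ k≤i))

-- The words 1...10...0 and the change of a single letter

module _ {n : ℕ} where

  abstract

    -- `k` counts the ones, so the last 1 of `step (suc (toℕ j))` is at `j`, and `step 0` is the
    -- zero word. The definition is opaque: later proofs see the letters only through `step-<` and
    -- `step-≥`.
    step : ℕ → Tri n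
    step k = tabulate f , [ (λ i _ → t2 i) , t3 ]
      where
      f : Fin n → Fin 3
      f i = stepLetter k (toℕ i)
      at : ∀ i → lookup (tabulate f) i ≡ f i
      at = Vec.lookup∘tabulate f
      t2 : ∀ i → lookup (tabulate f) i ≢ 2F
      t2 i eq with toℕ i ℕ.<? k
      ... | yes i<k with () ← trans (sym eq) (trans (at i) (stepLetter-< i<k))
      ... | no  i≮k with () ← trans (sym eq) (trans (at i) (stepLetter-≥ (ℕ.≮⇒≥ i≮k)))
      t3 : ∀ i → lookup (tabulate f) i ≡ 0F → ∀ j → i Fin.< j → lookup (tabulate f) j ≢ 1F
      t3 i eq0 j i<j eq1 with toℕ i ℕ.<? k
      ... | yes i<k with () ← trans (sym eq0) (trans (at i) (stepLetter-< i<k))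
      ... | no  i≮k with () ← trans (sym eq1)
        (trans (at j) (stepLetter-≥ (ℕ.≤-trans (ℕ.≮⇒≥ i≮k) (ℕ.<⇒≤ i<j))))

    step-< : ∀ {k i} → toℕ i ℕ.< k → step k ! i ≡ 1F
    step-< {k} {i} i<k = trans (Vec.lookup∘tabulate (λ j → stepLetter k (toℕ j)) i) (stepLetter-< i<k)

    step-≥ : ∀ {k i} → k ℕ.≤ toℕ i → step k ! i ≡ 0F
    step-≥ {k} {i} k≤i = trans (Vec.lookup∘tabulate (λ j → stepLetter k (toℕ j)) i) (stepLetter-≥ k≤i)

  step-≢2 : ∀ k i → step k ! i ≢ 2F
  step-≢2 k i eq with toℕ i ℕ.<? k
  ... | yes i<k with () ← trans (sym eq) (step-< i<k)
  ... | no  i≮k with () ← trans (sym eq) (step-≥ (ℕ.≮⇒≥ i≮k))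

  step-≤ : ∀ {k} {u : Tri n} → (∀ i → toℕ i ℕ.< k → u ! i ≢ 0F) → step k ≤ᵀ u
  step-≤ {k} {u} u≢0 i with toℕ i ℕ.<? k
  ... | yes i<k = subst (Fin._≤ u ! i) (sym (step-< i<k)) (≢0⇒1≤ (u≢0 i i<k))
  ... | no  i≮k = 0≤ (step-≥ (ℕ.≮⇒≥ i≮k))

  step-≤⁻ : ∀ {k} {u : Tri n} → step k ≤ᵀ u → ∀ i → toℕ i ℕ.< k → u ! i ≢ 0F
  step-≤⁻ {u = u} s≤u i i<k = 1≤⇒≢0 (subst (Fin._≤ u ! i) (step-< i<k) (s≤u i))

  one⇒step≤ : ∀ {u : Tri n} {j} → u ! j ≡ 1F → step (suc (toℕ j)) ≤ᵀ u
  one⇒step≤ {u} {j} u1 = step-≤ {u = u} λ i i<1+j u0 → nonzero i u0 (ℕ.m≤n⇒m<n∨m≡n (ℕ.≤-pred i<1+j))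
    where
    nonzero : ∀ i → u ! i ≡ 0F → ¬ ((toℕ i ℕ.< toℕ j) ⊎ (toℕ i ≡ toℕ j))
    nonzero i u0 (inj₁ i<j) = no-1-after-0 u i<j u0 u1
    nonzero i u0 (inj₂ i≡j) with refl ← Fin.toℕ-injective i≡j with () ← trans (sym u0) u1

  step-injective : ∀ {j k} → step (suc (toℕ j)) ≡ step (suc (toℕ k)) → j ≡ k
  step-injective {j} {k} eq = Fin.toℕ-injective (ℕ.≤-antisym (le eq) (le (sym eq)))
    where
    le : ∀ {j k : Fin n} → step (suc (toℕ j)) ≡ step (suc (toℕ k)) → toℕ j ℕ.≤ toℕ k
    le {j} {k} eq with toℕ j ℕ.≤? toℕ k
    ... | yes j≤k = j≤k
    ... | no j≰k with () ← trans (trans (sym (step-< (ℕ.n<1+n (toℕ j)))) (cong (_! j) eq))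
                             (step-≥ (ℕ.≰⇒> j≰k))

  update : ∀ (u : Tri n) i x → (toℕ i ≡ 0 → x ≢ 2F) →
    (x ≡ 0F → ∀ j → i Fin.< j → u ! j ≢ 1F) → (x ≡ 1F → ∀ j → j Fin.< i → u ! j ≢ 0F) → Tri n
  update u i x x≢2 after before = (value u [ i ]≔ x) , [ t2 , t3 ]
    where
    w = value u [ i ]≔ x
    t2 : ∀ k → toℕ k ≡ 0 → lookup w k ≢ 2F
    t2 k k≡0 eq with k Fin.≟ i
    ... | yes refl = x≢2 k≡0 (trans (sym (Vec.lookup∘update i (value u) x)) eq)
    ... | no k≢i   = proj₁ (isTriword u) k k≡0 (trans (sym (Vec.lookup∘update′ k≢i (value u) x)) eq)
    t3 : ∀ k → lookup w k ≡ 0F → ∀ j → k Fin.< j → lookup w j ≢ 1F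
    t3 k eq0 j k<j eq1 with k Fin.≟ i | j Fin.≟ i
    ... | yes refl | yes refl = ℕ.<-irrefl refl k<j
    ... | yes refl | no j≢i   = after (trans (sym (Vec.lookup∘update i (value u) x)) eq0) j k<j
      (trans (sym (Vec.lookup∘update′ j≢i (value u) x)) eq1)
    ... | no k≢i   | yes refl = before (trans (sym (Vec.lookup∘update i (value u) x)) eq1) k k<j
      (trans (sym (Vec.lookup∘update′ k≢i (value u) x)) eq0)
    ... | no k≢i   | no j≢i   = no-1-after-0 u k<j
      (trans (sym (Vec.lookup∘update′ k≢i (value u) x)) eq0)
      (trans (sym (Vec.lookup∘update′ j≢i (value u) x)) eq1)

-- The words with a single 2, and the labels of covers

module _ {m : ℕ} where

  twoLetter : Fin m → Fin (suc m) → Fin 3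
  twoLetter i k = if does (k Fin.≟ suc i) then 2F else 0F

  abstract

    -- The index is shifted by one because the first letter is never a 2: `Fin m` runs over exactly
    -- the positions that can hold one.
    two : Fin m → Tri (suc m)
    two i = tabulate (twoLetter i) , [ t2 , (λ _ _ j _ → t3 j) ]
      where
      t2 : ∀ k → toℕ k ≡ 0 → lookup (tabulate (twoLetter i)) k ≢ 2F
      t2 zero _ ()
      t3 : ∀ j → lookup (tabulate (twoLetter i)) j ≢ 1F
      t3 j eq with does (j Fin.≟ suc i) | trans (sym (Vec.lookup∘tabulate (twoLetter i) j)) eq
      ... | true  | ()
      ... | false | ()

    two-self : ∀ i → two i ! suc i ≡ 2F
    two-self i = trans (Vec.lookup∘tabulate (twoLetter i) (suc i))
      (cong (if_then 2F else 0F) (dec-true (suc i Fin.≟ suc i) refl))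

    two-other : ∀ {i k} → k ≢ suc i → two i ! k ≡ 0F
    two-other {i} {k} k≢i = trans (Vec.lookup∘tabulate (twoLetter i) k)
      (cong (if_then 2F else 0F) (dec-false (k Fin.≟ suc i) k≢i))

  two-≤ : ∀ {i} {u : Tri (suc m)} → u ! suc i ≡ 2F → two i ≤ᵀ u
  two-≤ {i} {u} u2 k with k Fin.≟ suc i
  ... | yes refl = Fin.≤-reflexive (trans (two-self i) (sym u2))
  ... | no  k≢i  = 0≤ (two-other k≢i)

  two-≤⁻ : ∀ {i} {u : Tri (suc m)} → two i ≤ᵀ u → u ! suc i ≡ 2F
  two-≤⁻ {i} {u} le = 2≤⇒≡2 (subst (Fin._≤ u ! suc i) (two-self i) (le (suc i)))

  two-injective : ∀ {i j} → two i ≡ two j → i ≡ j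
  two-injective {i} {j} eq with suc i Fin.≟ suc j
  ... | yes refl = refl
  ... | no  i≢j with () ← trans (sym (two-self i)) (trans (cong (_! suc i) eq) (two-other i≢j))

  two≢step : ∀ {i k} → two i ≢ step k
  two≢step {i} {k} eq = step-≢2 k (suc i) (trans (cong (_! suc i) (sym eq)) (two-self i))

  open Hoch (suc m)
  open IsLattice (Hoch-isLattice {suc m}) using (x≤x∨y; y≤x∨y; ∨-least; x∧y≤x; x∧y≤y; ∧-greatest)
  open Finite (Tri-finite (suc m)) using (elems; complete)

  join-at : ∀ (u v : Tri (suc m)) i → (u ∨ᵀ v) ! i ≡ u ! i ⊔ v ! i
  join-at u v i = Vec.lookup-zipWith _⊔_ i (value u) (value v)

  -- The join is squeezed between `p` and `u`, and it is not `p` because it lies above `c`; a cover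
  -- leaves only `u`.
  cover-join : ∀ {p u c : Tri (suc m)} → p ⋖ u → c ≤ᵀ u → ¬ c ≤ᵀ p → p ∨ᵀ c ≡ u
  cover-join {p} {u} {c} ((p≤u , _) , cov) c≤u c≰p = decidable-stable ((p ∨ᵀ c) ≟ u) λ neq →
    cov (p ∨ᵀ c)
      ( (x≤x∨y p c , λ eq → c≰p (subst (c ≤ᵀ_) (sym eq) (y≤x∨y p c)))
      , (∨-least {p} {c} {u} p≤u c≤u , neq))

  -- A maximum of two letters is 2 only if one of them is. So every `d` that joins with `p` to `u`
  -- has a 2 at `suc i`, and `two i` is the least triword with a 2 there.
  label-two : ∀ {p u : Tri (suc m)} {i} → p ⋖ u → u ! suc i ≡ 2F → p ! suc i ≢ 2F → IsLabel p u (two i)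
  label-two {p} {u} {i} p⋖u u2 p≢2 =
    cover-join {p} {u} {two i} p⋖u (two-≤ {u = u} u2) (λ le → p≢2 (two-≤⁻ {u = p} le)) ,
    λ d eq → two-≤ {u = d} (⊔≡2 (p ! suc i) (d ! suc i) p≢2
      (trans (sym (join-at p d (suc i))) (trans (cong (_! suc i) eq) u2)))

  -- Here every `d` must have a 1 at `j`. By (T3) this forces nonzero letters up to `j`, and the
  -- least triword with such letters is the step.
  label-step : ∀ {p u : Tri (suc m)} {j} → p ⋖ u → u ! j ≡ 1F → p ! j ≡ 0F →
    IsLabel p u (step (suc (toℕ j)))
  label-step {p} {u} {j} p⋖u u1 p0 =
    cover-join {p} {u} {step (suc (toℕ j))} p⋖u (one⇒step≤ {u = u} u1) (λ le →
      step-≤⁻ {u = p} le j ℕ.≤-refl p0) ,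
    λ d eq → one⇒step≤ {u = d} (0⊔≡1 (p ! j) (d ! j) p0
      (trans (sym (join-at p d j)) (trans (cong (_! j) eq) u1)))

  label-unique : ∀ {p u c d : Tri (suc m)} → IsLabel p u c → IsLabel p u d → c ≡ d
  label-unique {c = c} {d} (pc , c-min) (pd , d-min) = antisym {c} {d} (c-min d pd) (d-min c pc)

  strict-at : ∀ {u v : Tri (suc m)} → u < v → ∃[ i ] u ! i Fin.< v ! i
  strict-at {u} {v} (u≤v , u≢v) with Fin.any? (λ i → u ! i Fin.<? v ! i)
  ... | yes p = p
  ... | no ¬p = contradiction
    (Tri-ext λ i → Fin.≤-antisym (u≤v i) (ℕ.≮⇒≥ λ u<v → ¬p (i , u<v))) u≢v

  data CoverLabel (p u c : Tri (suc m)) : Set where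
    is-two  : ∀ i → u ! suc i ≡ 2F → c ≡ two i → CoverLabel p u c
    is-step : ∀ j → u ! j ≡ 1F → p ! j ≡ 0F → c ≡ step (suc (toℕ j)) → CoverLabel p u c

  -- Labels are unique, so one letter at which `p` is strictly below `u` decides the label: either a
  -- 2 is lowered or a 1 becomes a 0.
  coverLabel : ∀ {p u c : Tri (suc m)} → p ⋖ u → IsLabel p u c → CoverLabel p u c
  coverLabel {p} {u} p⋖u lab with strict-at {p} {u} (proj₁ p⋖u)
  ... | k , p<u with <⇒0,1⊎2 (p ! k) (u ! k) p<u
  ...   | inj₁ (u1 , p0) = is-step k u1 p0 (label-unique {p} {u} lab (label-step {p} {u} p⋖u u1 p0))
  coverLabel {p} {u} p⋖u lab | zero  , p<u | inj₂ (u2 , _) = contradiction u2 (head≢2 u)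
  coverLabel {p} {u} p⋖u lab | suc i , p<u | inj₂ (u2 , p≢2) =
    is-two i u2 (label-unique {p} {u} lab (label-two {p} {u} p⋖u u2 p≢2))

  -- The nucleus and the last 1

  nucleus-≤ : ∀ {p u : Tri (suc m)} → p ⋖ u → nucleus u ≤ᵀ p
  nucleus-≤ {p} {u} p⋖u = lower _ (∈-filter⁺ (_⋖? u) (complete p) p⋖u)
    where
    lower : ∀ xs → p ∈ xs → foldr _∧ᵀ_ u xs ≤ᵀ p
    lower (x ∷ xs) (here refl) = x∧y≤x x (foldr _∧ᵀ_ u xs)
    lower (x ∷ xs) (there p∈) =
      ≤-trans {x ∧ᵀ foldr _∧ᵀ_ u xs} {foldr _∧ᵀ_ u xs} {p} (x∧y≤y x (foldr _∧ᵀ_ u xs)) (lower xs p∈)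

  nucleus-greatest : ∀ {d u : Tri (suc m)} → d ≤ᵀ u → (∀ p → p ⋖ u → d ≤ᵀ p) → d ≤ᵀ nucleus u
  nucleus-greatest {d} {u} d≤u d≤p =
    greatest _ (λ {p} p∈ → d≤p p (proj₂ (∈-filter⁻ (_⋖? u) {xs = elems} p∈)))
    where
    greatest : ∀ xs → (∀ {p} → p ∈ xs → d ≤ᵀ p) → d ≤ᵀ foldr _∧ᵀ_ u xs
    greatest [] _ = d≤u
    greatest (x ∷ xs) h =
      ∧-greatest {x = d} {x} {foldr _∧ᵀ_ u xs} (h (here refl)) (greatest xs (h ∘ there))

  NoOneAfter : Tri (suc m) → Fin (suc m) → Set
  NoOneAfter u j = ∀ k → j Fin.< k → u ! k ≢ 1F

  LastOne : Tri (suc m) → Fin (suc m) → Set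
  LastOne u j = u ! j ≡ 1F × NoOneAfter u j

  -- This expresses, without naming the last 1, that it is at some `l ≤ j` and that the letters
  -- after it up to `j` are 2s. The first letter is nonzero and never 2, so a last 1 exists.
  Stair : Tri (suc m) → Fin (suc m) → Set
  Stair u j = (∀ k → k Fin.≤ j → u ! k ≢ 0F) × NoOneAfter u j

  lastOne⇒stair : ∀ {u : Tri (suc m)} {l} → LastOne u l → Stair u l
  lastOne⇒stair {u} (u1 , after) =
    (λ k k≤l → step-≤⁻ {u = u} (one⇒step≤ {u = u} u1) k (s≤s k≤l)) , after

  lastOne-unique : ∀ {u : Tri (suc m)} {j k} → LastOne u j → LastOne u k → j ≡ k
  lastOne-unique {j = j} {k} (uj , aj) (uk , ak) with Fin.<-cmp j k
  ... | tri< j<k _ _ = contradiction uk (aj k j<k)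
  ... | tri≈ _ j≡k _ = j≡k
  ... | tri> _ _ k<j = contradiction uj (ak j k<j)

  lastOne : ∀ (u : Tri (suc m)) → u ! zero ≢ 0F → ∃ (LastOne u)
  lastOne u u≢0 =
    let l , l1 , after = last (value u) zero (≢0,≢2⇒≡1 u≢0 (head≢2 u)) in l , l1 , after
    where
    last : ∀ {n} (w : Vec (Fin 3) n) i → lookup w i ≡ 1F →
      ∃[ l ] lookup w l ≡ 1F × (∀ k → l Fin.< k → lookup w k ≢ 1F)
    last (x ∷ w) i eq with Fin.any? (λ k → lookup w k Fin.≟ 1F)
    ... | yes (k , w1) = let l , l1 , after = last w k w1 in
      suc l , l1 , λ { zero () ; (suc k) (s≤s l<k) → after k l<k }
    last (x ∷ w) zero eq | no ¬one = zero , eq , λ { zero () ; (suc k) _ w1 → ¬one (k , w1) }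
    last (x ∷ w) (suc i) eq | no ¬one = contradiction (i , eq) ¬one

  -- If a lower cover p of u had a zero at some i ≤ j, then u = p ∨ step (suc i), and the one of u
  -- at k would already be a one of p, to the right of that zero.
  step≤nucleus : ∀ {u : Tri (suc m)} {j k : Fin (suc m)} → j Fin.< k → u ! k ≡ 1F →
    step (suc (toℕ j)) ≤ᵀ nucleus u
  step≤nucleus {u} {j} {k} j<k u1 = nucleus-greatest {step (suc (toℕ j))} {u}
    (step-≤ {u = u} nz) λ p p⋖u → step-≤ {u = p} λ i i<1+j p0 →
      let i<k = ℕ.≤-<-trans (ℕ.≤-pred i<1+j) j<k
          eq  = cover-join {p} {u} {step (suc (toℕ i))} p⋖u
                  (step-≤ {u = u} λ h h<1+i → nz h (ℕ.≤-trans h<1+i i<1+j))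
                  (λ le → step-≤⁻ {u = p} le i ℕ.≤-refl p0)
      in no-1-after-0 p i<k p0 (⊔0≡1 (p ! k) (step (suc (toℕ i)) ! k) (step-≥ i<k)
           (trans (sym (join-at p (step (suc (toℕ i))) k)) (trans (cong (_! k) eq) u1)))
    where
    nz : ∀ i → toℕ i ℕ.< suc (toℕ j) → u ! i ≢ 0F
    nz i i<1+j = step-≤⁻ {u = u} (one⇒step≤ {u = u} u1) i (s≤s (ℕ.≤-trans (ℕ.≤-pred i<1+j) (ℕ.<⇒≤ j<k)))

  -- Lower covers in which a given letter is smaller

  -- Any lower cover `p` of `u` above `x` agrees with `u` away from `i`, as it is squeezed between
  -- `x` and `u`. Being different from `u`, it must be smaller at `i`.
  lower-at : ∀ {u x : Tri (suc m)} {i} → x ! i Fin.< u ! i → (∀ k → k ≢ i → x ! k ≡ u ! k) →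
    ∃[ p ] p ⋖ u × p ! i Fin.< u ! i
  lower-at {u} {x} {i} x<u agree =
    let p , x≤p , p⋖u@((p≤u , p≢u) , _) = lowerCover {x} {u} (x≤u , x≢u)
    in p , p⋖u , Fin.≤∧≢⇒< (p≤u i) λ eq → p≢u (antisym {p} {u} p≤u (u≤p {p} x≤p eq))
    where
    x≤u : x ≤ᵀ u
    x≤u k with k Fin.≟ i
    ... | yes refl = ℕ.<⇒≤ x<u
    ... | no k≢i   = Fin.≤-reflexive (agree k k≢i)
    x≢u : x ≢ u
    x≢u eq = ℕ.<-irrefl (cong (λ v → toℕ (v ! i)) eq) x<u
    u≤p : ∀ {p : Tri (suc m)} → x ≤ᵀ p → p ! i ≡ u ! i → u ≤ᵀ p
    u≤p {p} x≤p eq k with k Fin.≟ i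
    ... | yes refl = Fin.≤-reflexive (sym eq)
    ... | no k≢i   = subst (Fin._≤ p ! k) (agree k k≢i) (x≤p k)

  lower-update : ∀ {u : Tri (suc m)} {i} x → x Fin.< u ! i →
    (x ≡ 0F → ∀ j → i Fin.< j → u ! j ≢ 1F) → (x ≡ 1F → ∀ j → j Fin.< i → u ! j ≢ 0F) →
    ∃[ p ] p ⋖ u × p ! i Fin.< u ! i
  lower-update {u} {i} x x<u after before =
    lower-at {u} {update u i x x≢2 after before}
      (subst (Fin._< u ! i) (sym (Vec.lookup∘update i (value u) x)) x<u)
      (λ k k≢i → Vec.lookup∘update′ k≢i (value u) x)
    where
    x≢2 : toℕ i ≡ 0 → x ≢ 2F
    x≢2 _ refl = ℕ.<⇒≱ x<u (Fin.toℕ≤pred[n] (u ! i))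

  -- (T3) decides what the 2 can become. A 0 to the left excludes all later 1s, so the 2 may become
  -- a 0; if there is no 0 to the left, it may become a 1.
  lower-two : ∀ {u : Tri (suc m)} {i} → u ! suc i ≡ 2F → ∃[ p ] p ⋖ u × p ! suc i ≢ 2F
  lower-two {u} {i} u2 with Fin.any? (λ k → k Fin.<? suc i ×-dec u ! k Fin.≟ 0F)
  ... | yes (k , k<i , u0) =
    let p , p⋖u , p<u = lower-update {u} 0F (subst (Fin._<_ {3} 0F) (sym u2) (s≤s z≤n))
                          (λ _ j i<j → no-1-after-0 u (ℕ.<-trans k<i i<j) u0) (λ ())
    in p , p⋖u , λ p2 → ℕ.<-irrefl (cong toℕ (trans p2 (sym u2))) p<u
  ... | no ¬0 =
    let p , p⋖u , p<u = lower-update {u} 1F (subst (Fin._<_ {3} 1F) (sym u2) (s≤s (s≤s z≤n)))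
                          (λ ()) (λ _ j j<i u0 → ¬0 (j , j<i , u0))
    in p , p⋖u , λ p2 → ℕ.<-irrefl (cong toℕ (trans p2 (sym u2))) p<u

  lower-one : ∀ {u : Tri (suc m)} {l} → LastOne u l → ∃[ p ] p ⋖ u × p ! l ≡ 0F
  lower-one {u} {l} (u1 , after) =
    let p , p⋖u , p<u = lower-update {u} 0F (subst (Fin._<_ {3} 0F) (sym u1) (s≤s z≤n))
                          (λ _ → after) (λ ())
    in p , p⋖u , <1⇒≡0 (subst (p ! l Fin.<_) u1 p<u)
    where
    <1⇒≡0 : ∀ {x : Fin 3} → Fin._<_ {_} {3} x 1F → x ≡ 0F
    <1⇒≡0 {0F} _ = refl
    <1⇒≡0 {suc _} (s≤s ())

  -- Each 2 of `u` is lowered in some lower cover, and the nucleus lies below all of them. Hence the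
  -- nucleus has only the letters 0 and 1, which makes it comparable with steps in `Core⇒Ψ`.
  nucleus≢2 : ∀ (u : Tri (suc m)) i → nucleus u ! i ≢ 2F
  nucleus≢2 u zero eq = head≢2 (nucleus u) eq
  nucleus≢2 u (suc i) eq with u ! suc i Fin.≟ 2F
  ... | yes u2 = let p , p⋖u , p≢2 = lower-two {u} u2 in
    p≢2 (2≤⇒≡2 (subst (Fin._≤ p ! suc i) eq (nucleus-≤ {p} {u} p⋖u (suc i))))
  ... | no u≢2 = u≢2 (2≤⇒≡2 (subst (Fin._≤ u ! suc i) eq (nuc≤ (suc i))))
    where
    lower : ∀ xs → foldr _∧ᵀ_ u xs ≤ᵀ u
    lower [] = ≤-refl {u}
    lower (x ∷ xs) = ≤-trans {x ∧ᵀ foldr _∧ᵀ_ u xs} {foldr _∧ᵀ_ u xs} {u} (x∧y≤y x (foldr _∧ᵀ_ u xs))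
      (lower xs)
    nuc≤ : nucleus u ≤ᵀ u
    nuc≤ = lower (filter (_⋖? u) elems)

  -- These covers are the witnesses for the step labels in `Core⇒Ψ`.
  step-⋖ : ∀ j → step (toℕ j) ⋖ step (suc (toℕ j))
  step-⋖ j = (le , ne) , no-between
    where
    s = step (toℕ j)
    t = step (suc (toℕ j))
    le : s ≤ᵀ t
    le = step-≤ {u = t} λ i i<j eq → contradiction (trans (sym eq) (step-< (ℕ.m<n⇒m<1+n i<j))) λ ()
    ne : s ≢ t
    ne eq with () ← trans (sym (step-≥ {k = toℕ j} {j} ℕ.≤-refl))
                      (trans (cong (_! j) eq) (step-< (ℕ.n<1+n (toℕ j))))
    no-between : ∀ z → ¬ (s < z × z < t)
    no-between z ((s≤z , s≢z) , (z≤t , z≢t)) with z ! j in z-eq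
    ... | 1F = z≢t (antisym {z} {t} z≤t (one⇒step≤ {u = z} z-eq))
    ... | 2F = ≤1⇒≢2 (subst (λ x → Fin._≤_ {_} {3} x 1F) z-eq
      (subst (z ! j Fin.≤_) (step-< (ℕ.n<1+n (toℕ j))) (z≤t j))) refl
    ... | 0F = s≢z (antisym {s} {z} s≤z z≤s)
      where
      z≤s : z ≤ᵀ s
      z≤s k with Fin.<-cmp k j
      ... | tri< k<j _ _ = subst (z ! k Fin.≤_)
              (trans (step-< (ℕ.m<n⇒m<1+n k<j)) (sym (step-< k<j))) (z≤t k)
      ... | tri≈ _ refl _ = 0≤ z-eq
      ... | tri> _ _ j<k = subst (z ! k Fin.≤_)
              (trans (step-≥ j<k) (sym (step-≥ (ℕ.<⇒≤ j<k)))) (z≤t k)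

  -- Core labels and the core label order

  data Core (u c : Tri (suc m)) : Set where
    core-two   : ∀ i → u ! suc i ≡ 2F → c ≡ two i → Core u c
    core-stair : ∀ j → Stair u j → c ≡ step (suc (toℕ j)) → Core u c

  -- A 1 of `u` to the right of `j` would, by `step≤nucleus`, put `step (suc (toℕ j))` below the
  -- nucleus and hence below `b`, which has a 0 at `j`.
  Ψ⇒Core : ∀ {u c} → Ψ u c → Core u c
  Ψ⇒Core {u} {c} (b , b′ , nuc≤b , b⋖b′ , b′≤u , lab) with coverLabel {b} {b′} b⋖b′ lab
  ... | is-two i b2 c≡ = core-two i (2≤⇒≡2 (subst (Fin._≤ u ! suc i) b2 (b′≤u (suc i)))) c≡
  ... | is-step j b1 b0 c≡ = core-stair j
    ( (λ k k≤j → step-≤⁻ {u = u} (≤-trans {step (suc (toℕ j))} {b′} {u} (one⇒step≤ {u = b′} b1) b′≤u) k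
      (s≤s k≤j))
    , (λ k j<k u1 → step-≤⁻ {u = b}
         (≤-trans {step (suc (toℕ j))} {nucleus u} {b} (step≤nucleus {u} j<k u1) nuc≤b) j ℕ.≤-refl b0))
           c≡

  -- A 2 already gives a label at the top of the interval, from a lower cover of `u`. A stair at `j`
  -- is realised by `step (toℕ j) ⋖ step (suc (toℕ j))`: the nucleus has no 2 and vanishes from the
  -- last 1 of `u` onwards, which is at or before `j`, so it lies below `step (toℕ j)`.
  Core⇒Ψ : ∀ {u c} → Core u c → Ψ u c
  Core⇒Ψ {u} (core-two i u2 refl) = let p , p⋖u , p≢2 = lower-two {u} u2 in
    p , u , nucleus-≤ {p} {u} p⋖u , p⋖u , ≤-refl {u} , label-two {p} {u} p⋖u u2 p≢2
  Core⇒Ψ {u} (core-stair j (nz , after) refl) =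
    step (toℕ j) , step (suc (toℕ j)) , nuc≤ , step-⋖ j ,
    step-≤ {u = u} (λ k k<1+j → nz k (ℕ.≤-pred k<1+j)) ,
    label-step {step (toℕ j)} {step (suc (toℕ j))} (step-⋖ j) (step-< (ℕ.n<1+n (toℕ j)))
      (step-≥ {k = toℕ j} ℕ.≤-refl)
    where
    l : Fin (suc m)
    l = proj₁ (lastOne u (nz zero z≤n))
    l-last : LastOne u l
    l-last = proj₂ (lastOne u (nz zero z≤n))
    l≤j : l Fin.≤ j
    l≤j = ℕ.≮⇒≥ λ j<l → after l j<l (proj₁ l-last)
    nuc-l : nucleus u ! l ≡ 0F
    nuc-l = let p , p⋖u , p0 = lower-one {u} l-last in
      ≤0⇒≡0 (subst (nucleus u ! l Fin.≤_) p0 (nucleus-≤ {p} {u} p⋖u l))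
    nuc-0 : ∀ k → l Fin.≤ k → nucleus u ! k ≡ 0F
    nuc-0 k l≤k with ℕ.m≤n⇒m<n∨m≡n l≤k
    ... | inj₁ l<k = ≢1,≢2⇒≡0 (no-1-after-0 (nucleus u) l<k nuc-l) (nucleus≢2 u k)
    ... | inj₂ l≡k with refl ← Fin.toℕ-injective l≡k = nuc-l
    nuc≤ : nucleus u ≤ᵀ step (toℕ j)
    nuc≤ k with toℕ k ℕ.<? toℕ j
    ... | yes k<j = subst (nucleus u ! k Fin.≤_) (sym (step-< k<j)) (≢2⇒≤1 (nucleus≢2 u k))
    ... | no  k≮j = 0≤ (nuc-0 k (ℕ.≤-trans l≤j (ℕ.≮⇒≥ k≮j)))

  ⊑⇒ : ∀ {u v} → u ⊑ v →
    (∀ i → u ! suc i ≡ 2F → v ! suc i ≡ 2F) × (∀ l → LastOne u l → Stair v l)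
  ⊑⇒ {u} {v} u⊑v =
    (λ i u2 → at-two (Ψ⇒Core (u⊑v (two i) (Core⇒Ψ (core-two i u2 refl))))) ,
    (λ l last → at-step (Ψ⇒Core (u⊑v (step (suc (toℕ l)))
      (Core⇒Ψ (core-stair l (lastOne⇒stair {u} last) refl)))))
    where
    at-two : ∀ {i} → Core v (two i) → v ! suc i ≡ 2F
    at-two (core-two _ v2 eq) with refl ← two-injective eq = v2
    at-two (core-stair _ _ eq) = contradiction eq two≢step
    at-step : ∀ {l} → Core v (step (suc (toℕ l))) → Stair v l
    at-step (core-two _ _ eq) = contradiction (sym eq) two≢step
    at-step {l} (core-stair j st eq) = subst (Stair v) (sym (step-injective eq)) st

  -- The stair at the last 1 of `u` yields all others: up to a further stair `j` of `u`, the letters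
  -- after the last 1 are 2s of `u`, hence 2s of `v`, hence nonzero in `v`.
  ⇒⊑ : ∀ {u v} → (∀ i → u ! suc i ≡ 2F → v ! suc i ≡ 2F) → (∀ l → LastOne u l → Stair v l) → u ⊑ v
  ⇒⊑ {u} {v} twos stairs c Ψc with Ψ⇒Core {u} {c} Ψc
  ... | core-two i u2 eq = Core⇒Ψ (core-two i (twos i u2) eq)
  ... | core-stair j (nz , after) eq = Core⇒Ψ (core-stair j (nz-v , after-v) eq)
    where
    l : Fin (suc m)
    l = proj₁ (lastOne u (nz zero z≤n))
    l-last : LastOne u l
    l-last = proj₂ (lastOne u (nz zero z≤n))
    l≤j : l Fin.≤ j
    l≤j = ℕ.≮⇒≥ λ j<l → after l j<l (proj₁ l-last)
    after-v : NoOneAfter v j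
    after-v k j<k = proj₂ (stairs l l-last) k (ℕ.≤-<-trans l≤j j<k)
    nz-v : ∀ k → k Fin.≤ j → v ! k ≢ 0F
    nz-v k k≤j with toℕ k ℕ.≤? toℕ l
    ... | yes k≤l = proj₁ (stairs l l-last) k k≤l
    nz-v zero    k≤j | no k≰l = contradiction z≤n k≰l
    nz-v (suc k) k≤j | no k≰l = λ v0 →
      contradiction (trans (sym v0) (twos k
        (≢0,≢1⇒≡2 (nz (suc k) k≤j) (proj₂ l-last (suc k) (ℕ.≰⇒> k≰l))))) λ ()

  -- Canonical joinands and atoms

  data CanView (u c : Tri (suc m)) : Set where
    can-two  : ∀ i → u ! suc i ≡ 2F → c ≡ two i → CanView u c
    can-last : ∀ l → LastOne u l → c ≡ step (suc (toℕ l)) → CanView u c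

  -- A lower cover that turns the 1 at `j` into a 0 lies above the nucleus, so by `step≤nucleus` no
  -- 1 of `u` follows `j`.
  Can⇒CanView : ∀ {u c} → Can u c → CanView u c
  Can⇒CanView {u} (p , p⋖u , lab) with coverLabel {p} {u} p⋖u lab
  ... | is-two i u2 eq = can-two i u2 eq
  ... | is-step j u1 p0 eq = can-last j (u1 , λ k j<k uk → step-≤⁻ {u = p}
    (≤-trans {step (suc (toℕ j))} {nucleus u} {p} (step≤nucleus {u} j<k uk) (nucleus-≤ {p} {u} p⋖u)) j
      ℕ.≤-refl p0) eq

  CanView⇒Can : ∀ {u c} → CanView u c → Can u c
  CanView⇒Can {u} (can-two i u2 refl) = let p , p⋖u , p≢2 = lower-two {u} u2 in
    p , p⋖u , label-two {p} {u} p⋖u u2 p≢2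
  CanView⇒Can {u} (can-last l l-last refl) = let p , p⋖u , p0 = lower-one {u} l-last in
    p , p⋖u , label-step {p} {u} p⋖u (proj₁ l-last) p0

  step0≡zero : step 0 ≡ zeroTriword (suc m)
  step0≡zero = Tri-ext λ i → trans (step-≥ {k = 0} {i} z≤n) (sym (Vec.lookup-replicate i 0F))

  step1-atom : Atom (step 1)
  step1-atom = subst (_⋖ step 1) step0≡zero (step-⋖ zero)

  two-atom : ∀ i → Atom (two i)
  two-atom i = (z≤ , (λ eq → contradiction (trans (sym (cong (_! suc i) eq)) (zero-at (suc i)))
                      λ e → contradiction (trans (sym (two-self i)) e) λ ())) , no-between
    where
    o = zeroTriword (suc m)
    zero-at : ∀ k → o ! k ≡ 0F
    zero-at k = Vec.lookup-replicate k 0F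
    z≤ : o ≤ᵀ two i
    z≤ k = 0≤ (zero-at k)
    no-between : ∀ z → ¬ (o < z × z < two i)
    no-between z ((_ , o≢z) , (z≤t , z≢t)) with z ! suc i in z-eq
    ... | 2F = z≢t (antisym {z} {two i} z≤t (two-≤ {u = z} z-eq))
    ... | 1F = no-1-after-0 z {zero} {suc i} (s≤s z≤n)
                 (≤0⇒≡0 (subst (z ! zero Fin.≤_) (two-other λ ()) (z≤t zero))) z-eq
    ... | 0F = o≢z (Tri-ext λ k → trans (zero-at k) (sym (z0 k)))
      where
      z0 : ∀ k → z ! k ≡ 0F
      z0 k with k Fin.≟ suc i
      ... | yes refl = z-eq
      ... | no k≢i = ≤0⇒≡0 (subst (z ! k Fin.≤_) (two-other k≢i) (z≤t k))

  step-not-atom : ∀ i → ¬ Atom (step (suc (toℕ (suc i))))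
  step-not-atom i (_ , no-between) = no-between (step 1)
    ( proj₁ step1-atom
    , step-≤ {u = step (suc (toℕ (suc i)))} (λ k k<1 eq →
      contradiction (trans (sym eq) (step-< (ℕ.≤-trans k<1 (s≤s z≤n)))) λ ())
    , λ eq → contradiction (step-injective {j = zero} {suc i} eq) λ ())

-- Counting in finite types, and a criterion for the rank

sameElements⇒↭ : ∀ {A : Set} {xs ys : List A} → Unique xs → Unique ys →
  (∀ {x} → x ∈ xs ⇔ x ∈ ys) → xs ↭ ys
sameElements⇒↭ xs! ys! same = ∼bag⇒↭ (unique∧set⇒bag xs! ys! same)

module _ {A : Set} (fin : Finite A) where
  open Finite fin

  card-list : ∀ {P : Pred A 0ℓ} (P? : Decidable P) {xs} → Unique xs → (∀ {x} → P x ⇔ x ∈ xs) →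
    card P? ≡ length xs
  card-list P? xs! same = ↭-length (sameElements⇒↭ (Unique.filter⁺ P? unique) xs! (mk⇔
    (λ x∈ → Equivalence.to same (proj₂ (∈-filter⁻ P? {xs = elems} x∈)))
    (λ x∈ → ∈-filter⁺ P? (complete _) (Equivalence.from same x∈))))

module _ {A : Set} (fin : Finite A) {_≤_ : Rel A 0ℓ} (isDPO : IsDecPartialOrder _≡_ _≤_) where
  open Finite fin
  open FinitePoset fin isDPO

  -- Strict monotonicity makes `r y` a bound for the chains ending in `y`. The second hypothesis
  -- leads from `y` downwards in steps of one until `r` is 0, so a chain of that length exists.
  rank-unique : (r : A → ℕ) → (∀ {x y} → x < y → r x ℕ.< r y) →
    (∀ y → r y ≡ 0 ⊎ ∃[ x ] x < y × suc (r x) ≡ r y) → ∀ y → rank y ≡ r y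
  rank-unique r mono below = All.wfRec <-wellFounded 0ℓ (λ y → rank y ≡ r y) λ y rec →
    trans (rank-unfold y) (ℕ.≤-antisym (upper y rec) (lower y rec (below y)))
    where
    f : A → A → ℕ
    f y w = byDec (w <? y) (λ _ → suc (rank w)) 0
    upper : ∀ y → (∀ {w} → w < y → rank w ≡ r w) → max 0 (List.map (f y) elems) ℕ.≤ r y
    upper y rec = Extrema.max≤v⁺ z≤n (All.map⁺ (All.universal bound elems))
      where
      bound : ∀ w → f y w ℕ.≤ r y
      bound w with w <? y
      ... | yes w<y = subst (λ k → suc k ℕ.≤ r y) (sym (rec w<y)) (mono w<y)
      ... | no  _   = z≤n
    lower : ∀ y → (∀ {w} → w < y → rank w ≡ r w) → r y ≡ 0 ⊎ ∃[ x ] x < y × suc (r x) ≡ r y →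
      r y ℕ.≤ max 0 (List.map (f y) elems)
    lower y rec (inj₁ eq) = subst (ℕ._≤ max 0 (List.map (f y) elems)) (sym eq) z≤n
    lower y rec (inj₂ (x , x<y , eq)) =
      Extrema.v≤max⁺ 0 (List.map (f y) elems) (inj₂ (Any.map⁺ (lose (complete x) bound)))
      where
      bound : r y ℕ.≤ f y x
      bound with x <? y
      ... | yes _   = ℕ.≤-reflexive (sym (trans (cong suc (rec x<y)) eq))
      ... | no  x≮y = contradiction x<y x≮y

-- Codes of triwords

data Pointed : ℕ → Set where
  here  : ∀ {m} → Subset m → Pointed (suc m)
  there : ∀ {m} → Bool → Pointed m → Pointed (suc m)

support : ∀ {m} → Pointed m → Subset m
support (here A)    = outside ∷ A
support (there b P) = b ∷ support P

point : ∀ {m} → Pointed m → Fin m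
point (here _)    = zero
point (there _ P) = suc (point P)

-- The set of the positions of the letter 2, together with the position of the last letter 1:
-- there is none, it is the first letter, or it comes later.  As the first letter is never 2, the
-- element i of Fin m stands for the position suc i.
data Code (m : ℕ) : Set where
  none first : Subset m → Code m
  later      : Pointed m → Code m

twos : ∀ {m} → Code m → Subset m
twos (none A)  = A
twos (first A) = A
twos (later P) = support P

last : ∀ {m} → Code m → Maybe (Fin (suc m))
last (none A)  = nothing
last (first A) = just zero
last (later P) = just (suc (point P))

subsetWord : ∀ {m} → Subset m → Word m
subsetWord = Vec.map (if_then 2F else 0F)

-- (T3) leaves no choice for the letters other than 2: before the marked last 1 they are 1s, after
-- it they are 0s. So a subset with a marked position outside it determines the word.
pointedWord : ∀ {m} → Pointed m → Word m
pointedWord (here A)    = 1F ∷ subsetWord A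
pointedWord (there b P) = (if b then 2F else 1F) ∷ pointedWord P

codeWord : ∀ {m} → Code m → Word (suc m)
codeWord (none A)  = 0F ∷ subsetWord A
codeWord (first A) = 1F ∷ subsetWord A
codeWord (later P) = 1F ∷ pointedWord P

NoOne : ∀ {n} → Word n → Set
NoOne w = ∀ i → lookup w i ≢ 1F

No1After0 : ∀ {n} → Word n → Set
No1After0 w = ∀ i → lookup w i ≡ 0F → ∀ j → i Fin.< j → lookup w j ≢ 1F

subsetWord-noOne : ∀ {m} (A : Subset m) → NoOne (subsetWord A)
subsetWord-noOne (true  ∷ A) zero ()
subsetWord-noOne (false ∷ A) zero ()
subsetWord-noOne (_ ∷ A) (suc i) = subsetWord-noOne A i

noOne⇒no1After0 : ∀ {n x} {w : Word n} → NoOne w → No1After0 (x ∷ w)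
noOne⇒no1After0 no1 i _ (suc j) _ = no1 j

∷-no1After0 : ∀ {n x} {w : Word n} → x ≢ 0F → No1After0 w → No1After0 (x ∷ w)
∷-no1After0 x≢0 w3 zero x≡0 j _ = contradiction x≡0 x≢0
∷-no1After0 x≢0 w3 (suc i) w0 (suc j) (s≤s i<j) = w3 i w0 j i<j

pointedWord-no1After0 : ∀ {m} (P : Pointed m) → No1After0 (pointedWord P)
pointedWord-no1After0 (here A)        = noOne⇒no1After0 (subsetWord-noOne A)
pointedWord-no1After0 (there true P)  = ∷-no1After0 (λ ()) (pointedWord-no1After0 P)
pointedWord-no1After0 (there false P) = ∷-no1After0 (λ ()) (pointedWord-no1After0 P)

codeWord-triword : ∀ {m} (c : Code m) → IsTriword (codeWord c)
codeWord-triword (none A)  = (λ { zero _ () }) , noOne⇒no1After0 (subsetWord-noOne A)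
codeWord-triword (first A) = (λ { zero _ () }) , noOne⇒no1After0 (subsetWord-noOne A)
codeWord-triword (later P) = (λ { zero _ () }) , ∷-no1After0 (λ ()) (pointedWord-no1After0 P)

decode : ∀ {m} → Code m → Tri (suc m)
decode c = codeWord c , [ codeWord-triword c ]

subsetWord-2 : ∀ {m} (A : Subset m) i → lookup (subsetWord A) i ≡ 2F ⇔ i Subset.∈ A
subsetWord-2 (true  ∷ A) zero = mk⇔ (λ _ → here) (λ _ → refl)
subsetWord-2 (false ∷ A) zero = mk⇔ (λ ()) (λ ())
subsetWord-2 (_ ∷ A) (suc i) =
  mk⇔ (there ∘ Equivalence.to (subsetWord-2 A i))
    (Equivalence.from (subsetWord-2 A i) ∘ Subset.drop-there)

pointedWord-2 : ∀ {m} (P : Pointed m) i → lookup (pointedWord P) i ≡ 2F ⇔ i Subset.∈ support P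
pointedWord-2 (here A) zero = mk⇔ (λ ()) (λ ())
pointedWord-2 (here A) (suc i) =
  mk⇔ (there ∘ Equivalence.to (subsetWord-2 A i))
    (Equivalence.from (subsetWord-2 A i) ∘ Subset.drop-there)
pointedWord-2 (there true P) zero = mk⇔ (λ _ → here) (λ _ → refl)
pointedWord-2 (there false P) zero = mk⇔ (λ ()) (λ ())
pointedWord-2 (there b P) (suc i) =
  mk⇔ (there ∘ Equivalence.to (pointedWord-2 P i))
    (Equivalence.from (pointedWord-2 P i) ∘ Subset.drop-there)

decode-2 : ∀ {m} (c : Code m) i → decode c ! suc i ≡ 2F ⇔ i Subset.∈ twos c
decode-2 (none A)  = subsetWord-2 A
decode-2 (first A) = subsetWord-2 A
decode-2 (later P) = pointedWord-2 P

pointedWord-1 : ∀ {m} (P : Pointed m) → lookup (pointedWord P) (point P) ≡ 1F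
pointedWord-1 (here A)    = refl
pointedWord-1 (there b P) = pointedWord-1 P

pointedWord-noOneAfter : ∀ {m} (P : Pointed m) k → point P Fin.< k → lookup (pointedWord P) k ≢ 1F
pointedWord-noOneAfter (here A) (suc k) _ = subsetWord-noOne A k
pointedWord-noOneAfter (there b P) (suc k) (s≤s p<k) = pointedWord-noOneAfter P k p<k

last⇒lastOne : ∀ {m} (c : Code m) {l} → last c ≡ just l → LastOne (decode c) l
last⇒lastOne (first A) refl = refl , λ { (suc k) _ → subsetWord-noOne A k }
last⇒lastOne (later P) refl = pointedWord-1 P , λ { (suc k) (s≤s p<k) → pointedWord-noOneAfter P k p<k }

lastOne⇒last : ∀ {m} (c : Code m) {l} → LastOne (decode c) l → last c ≡ just l
lastOne⇒last (none A) {suc l} (u1 , _) = contradiction u1 (subsetWord-noOne A l)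
lastOne⇒last c@(first A) lst = cong just (lastOne-unique {u = decode c} (last⇒lastOne c refl) lst)
lastOne⇒last c@(later P) lst = cong just (lastOne-unique {u = decode c} (last⇒lastOne c refl) lst)

-- Deciding the order on codes

WordStair : ∀ {n} → Word n → Fin n → Set
WordStair w j = (∀ k → k Fin.≤ j → lookup w k ≢ 0F) × (∀ k → j Fin.< k → lookup w k ≢ 1F)

stair-zero : ∀ {n x} {w : Word n} → x ≢ 0F → NoOne w → WordStair (x ∷ w) zero
stair-zero x≢0 no1 = (λ { zero _ → x≢0 }) , λ { (suc k) _ → no1 k }

stair-suc : ∀ {n x} {w : Word n} {j} → x ≢ 0F → WordStair w j → WordStair (x ∷ w) (suc j)
stair-suc x≢0 (nz , no1) =
  (λ { zero _ → x≢0 ; (suc k) (s≤s k≤j) → nz k k≤j }) , λ { (suc k) (s≤s j<k) → no1 k j<k }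

stair-tail : ∀ {n x} {w : Word n} {j} → WordStair (x ∷ w) (suc j) → WordStair w j
stair-tail (nz , no1) = (λ k k≤j → nz (suc k) (s≤s k≤j)) , λ k j<k → no1 (suc k) (s≤s j<k)

-- This and the next decisions recurse along the code instead of testing all positions, so that
-- their `does` computes constructor by constructor. The sums over `subsets` and `pointeds` then
-- split with their Boolean conditions already simplified.
subsetStair? : ∀ {m} (A : Subset m) j → Dec (WordStair (subsetWord A) j)
subsetStair? (false ∷ A) j       = no λ (nz , _) → nz zero z≤n refl
subsetStair? (true  ∷ A) zero    = yes (stair-zero (λ ()) (subsetWord-noOne A))
subsetStair? (true  ∷ A) (suc j) = map′ (stair-suc λ ()) stair-tail (subsetStair? A j)

firstStair? : ∀ {m} (A : Subset m) j → Dec (WordStair (1F ∷ subsetWord A) j)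
firstStair? A zero    = yes (stair-zero (λ ()) (subsetWord-noOne A))
firstStair? A (suc j) = map′ (stair-suc λ ()) stair-tail (subsetStair? A j)

pointedStair? : ∀ {m} (P : Pointed m) j → Dec (WordStair (pointedWord P) j)
pointedStair? (here A)    j       = firstStair? A j
pointedStair? (there b P) zero    = no λ (_ , no1) → no1 (suc (point P)) (s≤s z≤n) (pointedWord-1 P)
pointedStair? (there b P) (suc j) = map′ (stair-suc (nz b)) stair-tail (pointedStair? P j)
  where
  nz : ∀ b → (if b then 2F else 1F) ≢ 0F
  nz true ()
  nz false ()

codeStair? : ∀ {m} (c : Code m) j → Dec (Stair (decode c) j)
codeStair? (none A)  j       = no λ (nz , _) → nz zero z≤n refl
codeStair? (first A) j       = firstStair? A j
codeStair? (later P) zero    = no λ (_ , no1) → no1 (suc (point P)) (s≤s z≤n) (pointedWord-1 P)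
codeStair? (later P) (suc j) = map′ (stair-suc λ ()) stair-tail (pointedStair? P j)

stairAt? : ∀ {m} (c : Code m) l? → Dec (∀ l → l? ≡ just l → Stair (decode c) l)
stairAt? c nothing  = yes λ _ ()
stairAt? c (just l) = map′ (λ { st _ refl → st }) (λ f → f l refl) (codeStair? c l)

CodeLe : ∀ {m} → Code m → Code m → Set
CodeLe c d = (∀ l → last c ≡ just l → Stair (decode d) l) × twos c ⊆ twos d

codeLe? : ∀ {m} (c d : Code m) → Dec (CodeLe c d)
codeLe? c d = stairAt? d (last c) ×-dec (twos c Subset.⊆? twos d)

⊑⇔CodeLe : ∀ {m} (c d : Code m) → Hoch._⊑_ (suc m) (decode c) (decode d) ⇔ CodeLe c d
⊑⇔CodeLe c d = mk⇔
  (λ le → let two , st = ⊑⇒ {u = decode c} {decode d} le in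
    (λ l eq → st l (last⇒lastOne c eq)) ,
    λ {x} x∈ → Equivalence.to (decode-2 d x) (two x (Equivalence.from (decode-2 c x) x∈)))
  (λ (st , sub) → ⇒⊑ {u = decode c} {decode d}
    (λ i u2 → Equivalence.from (decode-2 d i) (sub (Equivalence.to (decode-2 c i) u2)))
    (λ l lst → st l (lastOne⇒last c lst)))

-- The bijection between codes and triwords

parse : ∀ {m} (w : Word m) → No1After0 w → (∃[ A ] subsetWord A ≡ w) ⊎ (∃[ P ] pointedWord P ≡ w)
parse [] _ = inj₁ ([] , refl)
parse (x ∷ w) w3 with parse w (λ i w0 j i<j → w3 (suc i) w0 (suc j) (s≤s i<j))
parse (0F ∷ w) w3 | inj₁ (A , refl) = inj₁ (false ∷ A , refl)
parse (1F ∷ w) w3 | inj₁ (A , refl) = inj₂ (here A , refl)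
parse (2F ∷ w) w3 | inj₁ (A , refl) = inj₁ (true ∷ A , refl)
parse (0F ∷ w) w3 | inj₂ (P , refl) = contradiction (pointedWord-1 P)
  (w3 zero refl (suc (point P)) (s≤s z≤n))
parse (1F ∷ w) w3 | inj₂ (P , refl) = inj₂ (there false P , refl)
parse (2F ∷ w) w3 | inj₂ (P , refl) = inj₂ (there true P , refl)

decode-surjective : ∀ {m} (u : Tri (suc m)) → ∃[ c ] decode c ≡ u
decode-surjective {m} u = go (value u) (isTriword u) refl
  where
  go : ∀ w → IsTriword w → w ≡ value u → ∃[ c ] decode c ≡ u
  go (x ∷ w) (w2 , w3) eq with parse w (λ i w0 j i<j → w3 (suc i) w0 (suc j) (s≤s i<j))
  go (0F ∷ w) (w2 , w3) eq | inj₁ (A , refl) = none A , value-injective eq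
  go (1F ∷ w) (w2 , w3) eq | inj₁ (A , refl) = first A , value-injective eq
  go (2F ∷ w) (w2 , w3) eq | _ = contradiction refl (w2 zero refl)
  go (0F ∷ w) (w2 , w3) eq | inj₂ (P , refl) =
    contradiction (pointedWord-1 P) (w3 zero refl (suc (point P)) (s≤s z≤n))
  go (1F ∷ w) (w2 , w3) eq | inj₂ (P , refl) = later P , value-injective eq

subsetWord-injective : ∀ {m} {A B : Subset m} → subsetWord A ≡ subsetWord B → A ≡ B
subsetWord-injective {A = A} {B} eq = Subset.⊆-antisym
  (λ {x} x∈ → Equivalence.to (subsetWord-2 B x)
    (trans (cong (λ w → lookup w x) (sym eq)) (Equivalence.from (subsetWord-2 A x) x∈)))
  (λ {x} x∈ → Equivalence.to (subsetWord-2 A x)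
    (trans (cong (λ w → lookup w x) eq) (Equivalence.from (subsetWord-2 B x) x∈)))

subsetWord≢pointedWord : ∀ {m} {A : Subset m} {P} → subsetWord A ≢ pointedWord P
subsetWord≢pointedWord {A = A} {P} eq =
  subsetWord-noOne A (point P) (trans (cong (λ w → lookup w (point P)) eq) (pointedWord-1 P))

pointedWord-injective : ∀ {m} {P Q : Pointed m} → pointedWord P ≡ pointedWord Q → P ≡ Q
pointedWord-injective {P = here A} {here B} eq = cong here (subsetWord-injective (Vec.∷-injectiveʳ eq))
pointedWord-injective {P = here A} {there b Q} eq =
  contradiction (Vec.∷-injectiveʳ eq) subsetWord≢pointedWord
pointedWord-injective {P = there b P} {here B} eq =
  contradiction (sym (Vec.∷-injectiveʳ eq)) subsetWord≢pointedWord
pointedWord-injective {P = there true P} {there true Q} eq =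
  cong (there true) (pointedWord-injective (Vec.∷-injectiveʳ eq))
pointedWord-injective {P = there false P} {there false Q} eq =
  cong (there false) (pointedWord-injective (Vec.∷-injectiveʳ eq))
pointedWord-injective {P = there true P} {there false Q} ()
pointedWord-injective {P = there false P} {there true Q} ()

codeWord-injective : ∀ {m} {c d : Code m} → codeWord c ≡ codeWord d → c ≡ d
codeWord-injective {c = none A} {none B} eq = cong none (subsetWord-injective (Vec.∷-injectiveʳ eq))
codeWord-injective {c = first A} {first B} eq = cong first (subsetWord-injective (Vec.∷-injectiveʳ eq))
codeWord-injective {c = later P} {later Q} eq = cong later (pointedWord-injective (Vec.∷-injectiveʳ eq))
codeWord-injective {c = first A} {later Q} eq =
  contradiction (Vec.∷-injectiveʳ eq) subsetWord≢pointedWord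
codeWord-injective {c = later P} {first B} eq =
  contradiction (sym (Vec.∷-injectiveʳ eq)) subsetWord≢pointedWord
codeWord-injective {c = none A} {first B} ()
codeWord-injective {c = none A} {later Q} ()
codeWord-injective {c = first A} {none B} ()
codeWord-injective {c = later P} {none B} ()

decode-injective : ∀ {m} {c d : Code m} → decode c ≡ decode d → c ≡ d
decode-injective eq = codeWord-injective (cong value eq)

-- Enumeration of the codes

subsets : ∀ m → List (Subset m)
subsets zero    = [] ∷ []
subsets (suc m) = List.map (outside ∷_) (subsets m) ++ List.map (inside ∷_) (subsets m)

pointeds : ∀ m → List (Pointed m)
pointeds zero    = []
pointeds (suc m) =
  List.map here (subsets m) ++ List.map (there outside) (pointeds m) ++ List.map (there inside)
    (pointeds m)

codes : ∀ m → List (Code m)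
codes m = List.map none (subsets m) ++ List.map first (subsets m) ++ List.map later (pointeds m)

∈-subsets : ∀ {m} (A : Subset m) → A ∈ subsets m
∈-subsets []          = here refl
∈-subsets (false ∷ A) = ∈-++⁺ˡ (∈-map⁺ _ (∈-subsets A))
∈-subsets (true  ∷ A) = ∈-++⁺ʳ _ (∈-map⁺ _ (∈-subsets A))

∈-pointeds : ∀ {m} (P : Pointed m) → P ∈ pointeds m
∈-pointeds (here A)        = ∈-++⁺ˡ (∈-map⁺ _ (∈-subsets A))
∈-pointeds {suc m} (there false P) = ∈-++⁺ʳ (List.map here (subsets m))
  (∈-++⁺ˡ (∈-map⁺ _ (∈-pointeds P)))
∈-pointeds {suc m} (there true P)  =
  ∈-++⁺ʳ (List.map here (subsets m)) (∈-++⁺ʳ (List.map (there outside) (pointeds m))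
    (∈-map⁺ _ (∈-pointeds P)))

∈-codes : ∀ {m} (c : Code m) → c ∈ codes m
∈-codes (none A)  = ∈-++⁺ˡ (∈-map⁺ _ (∈-subsets A))
∈-codes {m} (first A) = ∈-++⁺ʳ (List.map none (subsets m)) (∈-++⁺ˡ (∈-map⁺ _ (∈-subsets A)))
∈-codes {m} (later P) =
  ∈-++⁺ʳ (List.map none (subsets m)) (∈-++⁺ʳ (List.map first (subsets m)) (∈-map⁺ _ (∈-pointeds P)))

map-++-unique : ∀ {A B C : Set} {f : A → C} {g : B → C} {xs : List A} {ys : List B} →
  (∀ {x x′} → f x ≡ f x′ → x ≡ x′) → (∀ {y y′} → g y ≡ g y′ → y ≡ y′) → (∀ {x y} → f x ≢ g y) →
  Unique xs → Unique ys → Unique (List.map f xs ++ List.map g ys)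
map-++-unique f-inj g-inj f≢g xs! ys! =
  Unique.++⁺ (Unique.map⁺ f-inj xs!) (Unique.map⁺ g-inj ys!) λ (x∈ , y∈) →
    let _ , _ , x≡ = ∈-map⁻ _ x∈
        _ , _ , y≡ = ∈-map⁻ _ y∈
    in f≢g (trans (sym x≡) y≡)

map-++-++-unique : ∀ {A B C D : Set} {f : A → D} {g : B → D} {h : C → D} {xs ys zs} →
  (∀ {x x′} → f x ≡ f x′ → x ≡ x′) → (∀ {y y′} → g y ≡ g y′ → y ≡ y′) →
    (∀ {z z′} → h z ≡ h z′ → z ≡ z′) →
  (∀ {x y} → f x ≢ g y) → (∀ {x z} → f x ≢ h z) → (∀ {y z} → g y ≢ h z) →
  Unique xs → Unique ys → Unique zs → Unique (List.map f xs ++ List.map g ys ++ List.map h zs)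
map-++-++-unique {f = f} {g} {h} {xs} {ys} {zs} f-inj g-inj h-inj f≢g f≢h g≢h xs! ys! zs! =
  Unique.++⁺ (Unique.map⁺ f-inj xs!) (map-++-unique g-inj h-inj g≢h ys! zs!) λ (x∈ , yz∈) →
    let _ , _ , x≡ = ∈-map⁻ f x∈ in disjoint x≡ (∈-++⁻ (List.map g ys) yz∈)
  where
  disjoint : ∀ {v x} → v ≡ f x → ¬ (v ∈ List.map g ys ⊎ v ∈ List.map h zs)
  disjoint x≡ (inj₁ y∈) = let _ , _ , y≡ = ∈-map⁻ g y∈ in f≢g (trans (sym x≡) y≡)
  disjoint x≡ (inj₂ z∈) = let _ , _ , z≡ = ∈-map⁻ h z∈ in f≢h (trans (sym x≡) z≡)

subsets-unique : ∀ m → Unique (subsets m)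
subsets-unique zero    = All.[] ∷ []
subsets-unique (suc m) =
  map-++-unique Vec.∷-injectiveʳ Vec.∷-injectiveʳ (λ ()) (subsets-unique m) (subsets-unique m)

pointeds-unique : ∀ m → Unique (pointeds m)
pointeds-unique zero    = []
pointeds-unique (suc m) =
  map-++-++-unique (λ { refl → refl }) (λ { refl → refl }) (λ { refl → refl }) (λ ()) (λ ()) (λ ())
    (subsets-unique m) (pointeds-unique m) (pointeds-unique m)

codes-unique : ∀ m → Unique (codes m)
codes-unique m =
  map-++-++-unique (λ { refl → refl }) (λ { refl → refl }) (λ { refl → refl }) (λ ()) (λ ()) (λ ())
    (subsets-unique m) (subsets-unique m) (pointeds-unique m)

triwords↭codes : ∀ m → Finite.elems (Tri-finite (suc m)) ↭ List.map decode (codes m)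
triwords↭codes m = sameElements⇒↭ (Finite.unique (Tri-finite (suc m)))
  (Unique.map⁺ decode-injective (codes-unique m))
  (λ {u} → mk⇔ (λ _ → let c , eq = decode-surjective u in subst (_∈ List.map decode (codes m)) eq (∈-map⁺ decode (∈-codes c)))
               (λ _ → Finite.complete (Tri-finite (suc m)) u))

-- Numbers of canonical joinands and of atoms among them

elements : ∀ {m} → Subset m → List (Fin m)
elements []            = []
elements (outside ∷ A) = List.map suc (elements A)
elements (inside  ∷ A) = zero ∷ List.map suc (elements A)

length-elements : ∀ {m} (A : Subset m) → length (elements A) ≡ ∣ A ∣
length-elements []            = refl
length-elements (outside ∷ A) = trans (List.length-map suc (elements A)) (length-elements A)
length-elements (inside  ∷ A) = cong suc (trans (List.length-map suc (elements A)) (length-elements A))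

∈-elements : ∀ {m} {A : Subset m} {i} → i Subset.∈ A ⇔ i ∈ elements A
∈-elements {A = A} = mk⇔ (to A) (from A _)
  where
  to : ∀ {m} (A : Subset m) {i} → i Subset.∈ A → i ∈ elements A
  to (inside  ∷ A) here       = here refl
  to (inside  ∷ A) (there i∈) = there (∈-map⁺ suc (to A i∈))
  to (outside ∷ A) (there i∈) = ∈-map⁺ suc (to A i∈)
  from : ∀ {m} (A : Subset m) i → i ∈ elements A → i Subset.∈ A
  from (inside  ∷ A) i (here refl) = here
  from (inside  ∷ A) i (there i∈) with _ , j∈ , refl ← ∈-map⁻ suc i∈ = there (from A _ j∈)
  from (outside ∷ A) i i∈ with _ , j∈ , refl ← ∈-map⁻ suc i∈ = there (from A _ j∈)

elements-unique : ∀ {m} (A : Subset m) → Unique (elements A)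
elements-unique [] = []
elements-unique (outside ∷ A) = Unique.map⁺ Fin.suc-injective (elements-unique A)
elements-unique (inside  ∷ A) =
  All.map⁺ (All.universal (λ _ ()) (elements A)) ∷ Unique.map⁺ Fin.suc-injective (elements-unique A)

size : ∀ {m} → Code m → ℕ
size (none A)  = ∣ A ∣
size (first A) = suc ∣ A ∣
size (later P) = suc ∣ support P ∣

-- The step joinand is an atom only if its last 1 is the first letter, so it counts for `first A`
-- but not for `later P`.
atoms : ∀ {m} → Code m → ℕ
atoms (none A)  = ∣ A ∣
atoms (first A) = suc ∣ A ∣
atoms (later P) = ∣ support P ∣

module _ {m : ℕ} where

  firstOne : Code m → Maybe (Fin (suc m))
  firstOne (none A)  = nothing
  firstOne (first A) = just zero
  firstOne (later P) = nothing

  stepLabels : Maybe (Fin (suc m)) → List (Tri (suc m))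
  stepLabels nothing  = []
  stepLabels (just l) = step (suc (toℕ l)) ∷ []

  labels : Maybe (Fin (suc m)) → Subset m → List (Tri (suc m))
  labels l? A = stepLabels l? ++ List.map two (elements A)

  length-twoLabels : ∀ (A : Subset m) → length (List.map two (elements A)) ≡ ∣ A ∣
  length-twoLabels A = trans (List.length-map two (elements A)) (length-elements A)

  labels-unique : ∀ l? A → Unique (labels l? A)
  labels-unique nothing  A = Unique.map⁺ two-injective (elements-unique A)
  labels-unique (just l) A =
    All.map⁺ (All.universal (λ _ eq → two≢step (sym eq)) (elements A)) ∷ labels-unique nothing A

  data Label (l? : Maybe (Fin (suc m))) (A : Subset m) (x : Tri (suc m)) : Set where
    label-of-two  : ∀ i → i Subset.∈ A → x ≡ two i → Label l? A x
    label-of-step : ∀ l → l? ≡ just l → x ≡ step (suc (toℕ l)) → Label l? A x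

  ∈-labels⁺ : ∀ {l? A x} → Label l? A x → x ∈ labels l? A
  ∈-labels⁺ {l?} (label-of-two i i∈ refl) =
    ∈-++⁺ʳ (stepLabels l?) (∈-map⁺ two (Equivalence.to ∈-elements i∈))
  ∈-labels⁺ (label-of-step l refl eq) = here eq

  ∈-labels⁻ : ∀ {l? A x} → x ∈ labels l? A → Label l? A x
  ∈-labels⁻ {nothing} x∈ with i , i∈ , eq ← ∈-map⁻ two x∈ =
    label-of-two i (Equivalence.from ∈-elements i∈) eq
  ∈-labels⁻ {just l} (here eq) = label-of-step l refl eq
  ∈-labels⁻ {just l} (there x∈) with i , i∈ , eq ← ∈-map⁻ two x∈ =
    label-of-two i (Equivalence.from ∈-elements i∈) eq

  Can⇔ : ∀ c {x} → Hoch.Can (suc m) (decode c) x ⇔ Label (last c) (twos c) x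
  Can⇔ c {x} = mk⇔ (to ∘ Can⇒CanView {u = decode c}) (CanView⇒Can ∘ from)
    where
    to : CanView (decode c) x → Label (last c) (twos c) x
    to (can-two i u2 eq)   = label-of-two i (Equivalence.to (decode-2 c i) u2) eq
    to (can-last l lst eq) = label-of-step l (lastOne⇒last c lst) eq
    from : Label (last c) (twos c) x → CanView (decode c) x
    from (label-of-two i i∈ eq)   = can-two i (Equivalence.from (decode-2 c i) i∈) eq
    from (label-of-step l lst eq) = can-last l (last⇒lastOne c lst) eq

  Can∩Atom⇔ : ∀ c {x} → (Hoch.Can (suc m) (decode c) x × Atom x) ⇔ Label (firstOne c) (twos c) x
  Can∩Atom⇔ c {x} = mk⇔
    (λ (can , atom) → to c (Equivalence.to (Can⇔ c) can) atom)
    (λ lab → Equivalence.from (Can⇔ c) (from c lab) , atomic c lab)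
    where
    to : ∀ c → Label (last c) (twos c) x → Atom x → Label (firstOne c) (twos c) x
    to c (label-of-two i i∈ eq) _ = label-of-two i i∈ eq
    to (first A) (label-of-step l lst eq) _ = label-of-step l lst eq
    to (later P) (label-of-step l refl refl) atom = contradiction atom (step-not-atom (point P))
    from : ∀ c → Label (firstOne c) (twos c) x → Label (last c) (twos c) x
    from c (label-of-two i i∈ eq) = label-of-two i i∈ eq
    from (first A) (label-of-step l lst eq) = label-of-step l lst eq
    atomic : ∀ c → Label (firstOne c) (twos c) x → Atom x
    atomic c (label-of-two i _ refl) = two-atom i
    atomic (first A) (label-of-step _ refl refl) = step1-atom

  ∣Can∣-decode : ∀ c → ∣Can∣ (decode c) ≡ size c
  ∣Can∣-decode c = trans
    (card-list (Tri-finite (suc m)) (Hoch.Can? (suc m) (decode c)) (labels-unique (last c) (twos c))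
      (mk⇔ (∈-labels⁺ ∘ Equivalence.to (Can⇔ c)) (Equivalence.from (Can⇔ c) ∘ ∈-labels⁻)))
    (len c)
    where
    len : ∀ c → length (labels (last c) (twos c)) ≡ size c
    len (none A)  = length-twoLabels A
    len (first A) = cong suc (length-twoLabels A)
    len (later P) = cong suc (length-twoLabels (support P))

  neg-decode : ∀ c → neg (decode c) ≡ atoms c
  neg-decode c = trans
    (card-list (Tri-finite (suc m)) (λ x → Hoch.Can? (suc m) (decode c) x ×-dec atom? x)
      (labels-unique (firstOne c) (twos c))
      (mk⇔ (∈-labels⁺ ∘ Equivalence.to (Can∩Atom⇔ c)) (Equivalence.from (Can∩Atom⇔ c) ∘ ∈-labels⁻)))
    (len c)
    where
    len : ∀ c → length (labels (firstOne c) (twos c)) ≡ atoms c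
    len (none A)  = length-twoLabels A
    len (first A) = cong suc (length-twoLabels A)
    len (later P) = length-twoLabels (support P)

  -- The rank in the core label order

  encode : Tri (suc m) → Code m
  encode u = proj₁ (decode-surjective u)

  decode-encode : ∀ u → decode (encode u) ≡ u
  decode-encode u = proj₂ (decode-surjective u)

  encode-decode : ∀ c → encode (decode c) ≡ c
  encode-decode c = decode-injective (decode-encode (decode c))

  size≡ : ∀ c → size c ≡ length (stepLabels (last c)) ℕ.+ ∣ twos c ∣
  size≡ (none A)  = refl
  size≡ (first A) = refl
  size≡ (later P) = refl

  -- If both words have the same 2s, then the stair condition forces them to agree: up to the last
  -- 1 of c both have nonzero letters, and after it neither has a 1.
  size-< : ∀ {c d : Code m} → CodeLe c d → c ≢ d → size c ℕ.< size d
  size-< {c} {d} (st , sub) c≢d with twos c Subset.⊂? twos d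
  ... | yes c⊂d = subst₂ ℕ._<_ (sym (size≡ c)) (sym (size≡ d))
    (ℕ.+-mono-≤-< (steps-≤ (last c) (last d) refl refl) (Subset.p⊂q⇒∣p∣<∣q∣ c⊂d))
    where
    steps-≤ : ∀ l? k? → l? ≡ last c → k? ≡ last d → length (stepLabels l?) ℕ.≤ length (stepLabels k?)
    steps-≤ nothing  _        _ _ = z≤n
    steps-≤ (just l) (just k) _ _ = ℕ.≤-refl
    -- A stair makes the first letter of `decode d` nonzero, so `d` has a last 1 as well.
    steps-≤ (just l) nothing  p q with () ← trans q
      (lastOne⇒last d (proj₂ (lastOne (decode d) (proj₁ (st l (sym p)) zero z≤n))))
  ... | no c⊄d = strict (last c) (last d) refl refl
    where
    twos-⊇ : twos d ⊆ twos c
    twos-⊇ {i} i∈ with i Subset.∈? twos c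
    ... | yes i∈c = i∈c
    ... | no  i∉c = contradiction (sub , i , i∈ , i∉c) c⊄d
    twos≡ : twos c ≡ twos d
    twos≡ = Subset.⊆-antisym sub twos-⊇
    u = decode c
    v = decode d
    none≡ : ∀ (c d : Code m) → last c ≡ nothing → last d ≡ nothing → twos c ≡ twos d → c ≡ d
    none≡ (none A) (none B) _ _ refl = refl
    agree : ∀ l → LastOne u l → Stair v l → u ≡ v
    agree l lst@(u1 , no1) (nz , no1-v) = Tri-ext at
      where
      nz-u = proj₁ (lastOne⇒stair {u = u} lst)
      at-zero : u ! zero ≡ v ! zero
      at-zero = trans (≢0,≢2⇒≡1 (nz-u zero z≤n) (head≢2 u)) (sym (≢0,≢2⇒≡1 (nz zero z≤n) (head≢2 v)))
      at : ∀ k → u ! k ≡ v ! k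
      at zero = at-zero
      at (suc k) with u ! suc k Fin.≟ 2F | v ! suc k Fin.≟ 2F
      ... | yes u2 | _ = trans u2 (sym (Equivalence.from (decode-2 d k)
        (sub (Equivalence.to (decode-2 c k) u2))))
      ... | no u≢2 | yes v2 = contradiction
        (Equivalence.from (decode-2 c k) (twos-⊇ (Equivalence.to (decode-2 d k) v2))) u≢2
      ... | no u≢2 | no v≢2 with suc k Fin.≤? l
      ...   | yes k≤l = trans (≢0,≢2⇒≡1 (nz-u (suc k) k≤l) u≢2) (sym (≢0,≢2⇒≡1 (nz (suc k) k≤l) v≢2))
      ...   | no k≰l  = trans (≢1,≢2⇒≡0 (no1 (suc k) (ℕ.≰⇒> k≰l)) u≢2)
        (sym (≢1,≢2⇒≡0 (no1-v (suc k) (ℕ.≰⇒> k≰l)) v≢2))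
    strict : ∀ l? k? → l? ≡ last c → k? ≡ last d → size c ℕ.< size d
    strict nothing nothing p q = contradiction (none≡ c d (sym p) (sym q) twos≡) c≢d
    strict nothing (just k) p q = subst₂ ℕ._<_ (sym (size≡ c)) (sym (size≡ d))
      (subst₂ (λ x y → length (stepLabels x) ℕ.+ ∣ twos c ∣ ℕ.< length (stepLabels y) ℕ.+ ∣ twos d ∣) p
        q
        (s≤s (Subset.p⊆q⇒∣p∣≤∣q∣ sub)))
    strict (just l) _ p q = contradiction
      (decode-injective (agree l (last⇒lastOne c (sym p)) (st l (sym p)))) c≢d

  none-codeLe : ∀ {A} {d : Code m} → A ⊆ twos d → CodeLe (none A) d
  none-codeLe sub = (λ _ ()) , sub

  remove-element : ∀ {k} (A : Subset k) → ∣ A ∣ ≡ 0 ⊎ ∃[ B ] B ⊆ A × suc ∣ B ∣ ≡ ∣ A ∣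
  remove-element [] = inj₁ refl
  remove-element (inside ∷ A) = inj₂ (outside ∷ A , Subset.out⊆ id , refl)
  remove-element (outside ∷ A) with remove-element A
  ... | inj₁ eq = inj₁ eq
  ... | inj₂ (B , sub , eq) = inj₂ (outside ∷ B , Subset.out⊆ sub , eq)

  -- Dropping the step joinand lowers the size by one; in a word without 1, dropping a 2 does the
  -- same. Together with `size-<` this identifies `size` as the rank.
  predecessor : ∀ (d : Code m) → size d ≡ 0 ⊎ ∃[ c ] CodeLe c d × suc (size c) ≡ size d
  predecessor (none A) with remove-element A
  ... | inj₁ eq = inj₁ eq
  ... | inj₂ (B , sub , eq) = inj₂ (none B , none-codeLe {d = none A} sub , eq)
  predecessor d@(first A) = inj₂ (none A , none-codeLe {d = d} id , refl)
  predecessor d@(later P) = inj₂ (none (support P) , none-codeLe {d = d} id , refl)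

  private
    open module CLO-order = CLO (suc m) using (_<_; rank)

  ⊑-encode : ∀ {u v} → Hoch._⊑_ (suc m) u v → CodeLe (encode u) (encode v)
  ⊑-encode {u} {v} le = Equivalence.to (⊑⇔CodeLe (encode u) (encode v))
    (subst₂ (Hoch._⊑_ (suc m)) (sym (decode-encode u)) (sym (decode-encode v)) le)

  rank-decode : ∀ c → rank (decode c) ≡ size c
  rank-decode c = trans
    (rank-unique (Tri-finite (suc m)) (Hoch.⊑-isDecPartialOrder (suc m)) (size ∘ encode) mono below
      (decode c))
    (cong size (encode-decode c))
    where
    mono : ∀ {u v} → u < v → size (encode u) ℕ.< size (encode v)
    mono {u} {v} (le , u≢v) = size-< (⊑-encode le) λ eq →
      u≢v (trans (sym (decode-encode u)) (trans (cong decode eq) (decode-encode v)))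
    below : ∀ v → size (encode v) ≡ 0 ⊎ ∃[ u ] u < v × suc (size (encode u)) ≡ size (encode v)
    below v with predecessor (encode v)
    ... | inj₁ eq = inj₁ eq
    ... | inj₂ (c , le , eq) = inj₂ (decode c
      , ( subst (Hoch._⊑_ (suc m) (decode c)) (decode-encode v)
        (Equivalence.from (⊑⇔CodeLe c (encode v)) le)
        , λ { refl → ℕ.1+n≢n (trans eq (cong size (encode-decode c))) })
      , trans (cong (suc ∘ size) (encode-decode c)) eq)

-- Finite sums in a commutative ring

module Sums {c ℓ} (R : CommutativeRing c ℓ) where
  open CommutativeRing R renaming (refl to ≈-refl; sym to ≈-sym; trans to ≈-trans)
  open import Relation.Binary.Reasoning.Setoid setoid
  open Algebra.Properties.Ring ring using (-0#≈0#; -‿+-comm; -‿involutive)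
  open Mult semiring using (×-homo-+) renaming (_×_ to _×ᴿ_)
  open Triangle R using (fromℤ)
  open Solver commutativeSemiring using (solve; _:=_; _:+_; _:*_)

  private variable A B : Set

  ∑ : List A → (A → Carrier) → Carrier
  ∑ xs f = foldr _+_ 0# (List.map f xs)

  when : Bool → Carrier → Carrier
  when b a = if b then a else 0#

  ∑-cong : ∀ (xs : List A) {f g : A → Carrier} → (∀ x → f x ≈ g x) → ∑ xs f ≈ ∑ xs g
  ∑-cong []       eq = ≈-refl
  ∑-cong (x ∷ xs) eq = +-cong (eq x) (∑-cong xs eq)

  ∑-zero : ∀ (xs : List A) {f : A → Carrier} → (∀ x → f x ≈ 0#) → ∑ xs f ≈ 0#
  ∑-zero []       eq = ≈-refl
  ∑-zero (x ∷ xs) eq = ≈-trans (+-cong (eq x) (∑-zero xs eq)) (+-identityˡ 0#)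

  ∑-+ : ∀ (xs : List A) (f g : A → Carrier) → ∑ xs (λ x → f x + g x) ≈ ∑ xs f + ∑ xs g
  ∑-+ []       f g = ≈-sym (+-identityˡ 0#)
  ∑-+ (x ∷ xs) f g = ≈-trans (+-congˡ (∑-+ xs f g))
    (solve 4 (λ a b c d → (a :+ b) :+ (c :+ d) := (a :+ c) :+ (b :+ d)) ≈-refl (f x) (g x) (∑ xs f)
      (∑ xs g))

  ∑-*ˡ : ∀ (xs : List A) a (f : A → Carrier) → ∑ xs (λ x → a * f x) ≈ a * ∑ xs f
  ∑-*ˡ []       a f = ≈-sym (zeroʳ a)
  ∑-*ˡ (x ∷ xs) a f = ≈-trans (+-congˡ (∑-*ˡ xs a f)) (≈-sym (distribˡ a (f x) (∑ xs f)))

  ∑-++ : ∀ (xs ys : List A) (f : A → Carrier) → ∑ (xs ++ ys) f ≈ ∑ xs f + ∑ ys f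
  ∑-++ []       ys f = ≈-sym (+-identityˡ (∑ ys f))
  ∑-++ (x ∷ xs) ys f = ≈-trans (+-congˡ (∑-++ xs ys f)) (≈-sym (+-assoc (f x) (∑ xs f) (∑ ys f)))

  ∑-map : ∀ (h : A → B) xs (f : B → Carrier) → ∑ (List.map h xs) f ≈ ∑ xs (f ∘ h)
  ∑-map h []       f = ≈-refl
  ∑-map h (x ∷ xs) f = +-congˡ (∑-map h xs f)

  ∑-swap : ∀ (xs : List A) (ys : List B) (f : A → B → Carrier) →
    ∑ xs (λ x → ∑ ys (f x)) ≈ ∑ ys (λ y → ∑ xs (λ x → f x y))
  ∑-swap []       ys f = ≈-sym (∑-zero ys (λ _ → ≈-refl))
  ∑-swap (x ∷ xs) ys f =
    ≈-trans (+-congˡ (∑-swap xs ys f)) (≈-sym (∑-+ ys (f x) (λ y → ∑ xs (λ x → f x y))))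

  ∑-↭ : ∀ {xs ys : List A} (f : A → Carrier) → xs ↭ ys → ∑ xs f ≈ ∑ ys f
  ∑-↭ f Perm.refl         = ≈-refl
  ∑-↭ f (Perm.prep x p)   = +-congˡ (∑-↭ f p)
  ∑-↭ f (Perm.swap {xs} {ys} x y p) = ≈-trans (+-congˡ (+-congˡ (∑-↭ f p)))
    (solve 3 (λ a b c → a :+ (b :+ c) := b :+ (a :+ c)) ≈-refl (f x) (f y) (∑ ys f))
  ∑-↭ f (Perm.trans p q)  = ≈-trans (∑-↭ f p) (∑-↭ f q)

  when-cong : ∀ b {x y} → x ≈ y → when b x ≈ when b y
  when-cong true  eq = eq
  when-cong false _  = ≈-refl

  when-does-cong : ∀ {p} {P : Set p} (P? : Dec P) {x y} → (P → x ≈ y) →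
    when (does P?) x ≈ when (does P?) y
  when-does-cong (yes p) eq = eq p
  when-does-cong (no  _) eq = ≈-refl

  when-does-zero : ∀ {p} {P : Set p} (P? : Dec P) {x} → (P → x ≈ 0#) → when (does P?) x ≈ 0#
  when-does-zero (yes p) eq = eq p
  when-does-zero (no  _) eq = ≈-refl

  when-*ˡ : ∀ b a x → when b (a * x) ≈ a * when b x
  when-*ˡ true  a x = ≈-refl
  when-*ˡ false a x = ≈-sym (zeroʳ a)

  when-+ : ∀ b x y → when b (x + y) ≈ when b x + when b y
  when-+ true  x y = ≈-refl
  when-+ false x y = ≈-sym (+-identityˡ 0#)

  when-∑ : ∀ b (xs : List A) (f : A → Carrier) → when b (∑ xs f) ≈ ∑ xs (λ x → when b (f x))
  when-∑ true  xs f = ≈-refl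
  when-∑ false xs f = ≈-sym (∑-zero xs (λ _ → ≈-refl))

  ∑-when-*ˡ : ∀ (xs : List A) (b : A → Bool) a (f : A → Carrier) →
    ∑ xs (λ x → when (b x) (a * f x)) ≈ a * ∑ xs (λ x → when (b x) (f x))
  ∑-when-*ˡ xs b a f = ≈-trans (∑-cong xs (λ x → when-*ˡ (b x) a (f x))) (∑-*ˡ xs a _)

  fromℤ-⊖ : ∀ m n → fromℤ (m ℤ.⊖ n) ≈ m ×ᴿ 1# + - (n ×ᴿ 1#)
  fromℤ-⊖ zero zero = ≈-sym (≈-trans (+-identityˡ _) -0#≈0#)
  fromℤ-⊖ zero (suc n) = ≈-sym (+-identityˡ _)
  fromℤ-⊖ (suc m) zero = ≈-sym (≈-trans (+-congˡ -0#≈0#) (+-identityʳ _))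
  fromℤ-⊖ (suc m) (suc n) = begin
    fromℤ (suc m ℤ.⊖ suc n)                     ≡⟨ ≡.cong fromℤ (ℤ.[1+m]⊖[1+n]≡m⊖n m n) ⟩
    fromℤ (m ℤ.⊖ n)                             ≈⟨ fromℤ-⊖ m n ⟩
    a + - b                                     ≈⟨ +-identityˡ _ ⟨
    0# + (a + - b)                              ≈⟨ +-congʳ (-‿inverseʳ 1#) ⟨
    (1# + - 1#) + (a + - b)
      ≈⟨ solve 4 (λ o no a nb → (o :+ no) :+ (a :+ nb) := (o :+ a) :+ (no :+ nb))
                                                     ≈-refl 1# (- 1#) a (- b) ⟩
    (1# + a) + (- 1# + - b)                     ≈⟨ +-congˡ (-‿+-comm 1# b) ⟩
    (1# + a) + - (1# + b)                       ∎
    where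
    a = m ×ᴿ 1#
    b = n ×ᴿ 1#

  fromℤ-+ : ∀ i j → fromℤ (i ℤ.+ j) ≈ fromℤ i + fromℤ j
  fromℤ-+ (+ m)    (+ n)    = ×-homo-+ 1# m n
  fromℤ-+ (+ m)    -[1+ n ] = fromℤ-⊖ m (suc n)
  fromℤ-+ -[1+ m ] (+ n)    = ≈-trans (fromℤ-⊖ n (suc m)) (+-comm _ _)
  fromℤ-+ -[1+ m ] -[1+ n ] = begin
    - (suc (suc (m ℕ.+ n)) ×ᴿ 1#)               ≡⟨ ≡.cong (λ k → - (suc k ×ᴿ 1#)) (ℕ.+-suc m n) ⟨
    - ((suc m ℕ.+ suc n) ×ᴿ 1#)                 ≈⟨ -‿cong (×-homo-+ 1# (suc m) (suc n)) ⟩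
    - (suc m ×ᴿ 1# + suc n ×ᴿ 1#)               ≈⟨ -‿+-comm _ _ ⟨
    - (suc m ×ᴿ 1#) + - (suc n ×ᴿ 1#)           ∎

  fromℤ-neg : ∀ i → fromℤ (ℤ.- i) ≈ - fromℤ i
  fromℤ-neg (+ zero)  = ≈-sym -0#≈0#
  fromℤ-neg (+ suc n) = ≈-refl
  fromℤ-neg -[1+ n ]  = ≈-sym (-‿involutive _)

  fromℤ-∑ : ∀ (xs : List A) (f : A → ℤ) → fromℤ (foldr ℤ._+_ 0ℤ (List.map f xs)) ≈ ∑ xs (fromℤ ∘ f)
  fromℤ-∑ []       f = ≈-refl
  fromℤ-∑ (x ∷ xs) f = ≈-trans (fromℤ-+ (f x) _) (+-congˡ (fromℤ-∑ xs f))

  -- Möbius inversion in a finite poset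

  module Inversion {A : Set} (fin : Finite A) {_≤_ : Rel A 0ℓ} (isDPO : IsDecPartialOrder _≡_ _≤_) where
    open Finite fin
    open FinitePoset fin isDPO

    -- `∑≤` is the zeta transform of the order and `∑<` its strictly lower part.
    ∑≤ ∑< : (A → Carrier) → A → Carrier
    ∑≤ g w = ∑ elems (λ v → when (does (v ≤? w)) (g v))
    ∑< g w = ∑ elems (λ v → when (does (v <? w)) (g v))

    ∑-≡ : ∀ {xs : List A} (g : A → Carrier) {w} → Unique xs → w ∈ xs →
      ∑ xs (λ v → when (does (v ≟ w)) (g v)) ≈ g w
    ∑-≡ {x ∷ xs} g (x∉ ∷ _) (here ≡.refl) with x ≟ x
    ... | no x≢x = contradiction ≡.refl x≢x
    ... | yes _  = ≈-trans (+-congˡ (zeros xs x∉)) (+-identityʳ _)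
      where
      zeros : ∀ ys → All.All (x ≢_) ys → ∑ ys (λ v → when (does (v ≟ x)) (g v)) ≈ 0#
      zeros [] _ = ≈-refl
      zeros (y ∷ ys) (x≢y All.∷ x∉) with y ≟ x
      ... | yes y≡x = contradiction (≡.sym y≡x) x≢y
      ... | no _    = ≈-trans (+-identityˡ _) (zeros ys x∉)
    ∑-≡ {x ∷ xs} g {w} (x∉ ∷ xs!) (there w∈) with x ≟ w
    ... | yes ≡.refl = contradiction ≡.refl (All.lookup x∉ w∈)
    ... | no _       = ≈-trans (+-identityˡ _) (∑-≡ g xs! w∈)

    ∑≤-split : ∀ g w → ∑≤ g w ≈ g w + ∑< g w
    ∑≤-split g w = begin
      ∑≤ g w                                                                  ≈⟨ ∑-cong elems split ⟩
      ∑ elems (λ v → when (does (v ≟ w)) (g v) + when (does (v <? w)) (g v))  ≈⟨ ∑-+ elems _ _ ⟩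
      ∑ elems (λ v → when (does (v ≟ w)) (g v)) + ∑< g w
        ≈⟨ +-congʳ (∑-≡ g unique (complete w)) ⟩
      g w + ∑< g w                                                            ∎
      where
      split : ∀ v → when (does (v ≤? w)) (g v) ≈ when (does (v ≟ w)) (g v) + when (does (v <? w)) (g v)
      split v with v ≤? w | v ≟ w
      ... | yes _   | yes _   = ≈-sym (+-identityʳ _)
      ... | yes _   | no  _   = ≈-sym (+-identityˡ _)
      ... | no  v≰w | yes v≡w = contradiction (≤-reflexive v≡w) v≰w
      ... | no  _   | no  _   = ≈-sym (+-identityˡ _)

    -- The zeta transform is unitriangular: its value at `w` is `g w` plus values of `g` strictly
    -- below `w`, so `g` is recovered by well-founded induction.
    ∑≤-injective : ∀ {g h} → (∀ w → ∑≤ g w ≈ ∑≤ h w) → ∀ w → g w ≈ h w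
    ∑≤-injective {g} {h} eq = All.wfRec <-wellFounded _ (λ w → g w ≈ h w) λ w rec →
      +-cancelʳ (∑< g w) (g w) (h w) (begin
        g w + ∑< g w  ≈⟨ ∑≤-split g w ⟨
        ∑≤ g w        ≈⟨ eq w ⟩
        ∑≤ h w        ≈⟨ ∑≤-split h w ⟩
        h w + ∑< h w  ≈⟨ +-congˡ (∑-cong elems (λ v → below w rec v)) ⟨
        h w + ∑< g w  ∎)
      where
      open Algebra.Properties.Group +-group using () renaming (∙-cancelʳ to +-cancelʳ)
      below : ∀ w → (∀ {v} → v < w → g v ≈ h v) → ∀ v →
        when (does (v <? w)) (g v) ≈ when (does (v <? w)) (h v)
      below w rec v = when-does-cong (v <? w) rec

    μᴿ : A → A → Carrier
    μᴿ u v = fromℤ (μ u v)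

    μ-sum : A → A → ℤ
    μ-sum u w = sumℤ (λ v → byDec (u ≤? v ×-dec v <? w) (λ _ → μ u v) 0ℤ)

    ∑<-μ : ∀ u w → ∑< (μᴿ u) w ≈ fromℤ (μ-sum u w)
    ∑<-μ u w = ≈-sym (≈-trans (fromℤ-∑ elems _) (∑-cong elems term))
      where
      term : ∀ v → fromℤ (byDec (u ≤? v ×-dec v <? w) (λ _ → μ u v) 0ℤ) ≈ when (does (v <? w)) (μᴿ u v)
      term v = go (u ≤? v) (v <? w)
        where
        go : (P? : Dec (u ≤ v)) (Q? : Dec (v < w)) →
          fromℤ (byDec (P? ×-dec Q?) (λ _ → μ u v) 0ℤ) ≈ when (does Q?) (μᴿ u v)
        go (yes _)  (yes _) = ≈-refl
        go (no u≰v) (yes _) = ≈-sym (reflexive (≡.cong fromℤ (μ-≰ u≰v)))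
        go (yes _)  (no _)  = ≈-refl
        go (no _)   (no _)  = ≈-refl

    ∑<-μ-≮ : ∀ {u w} → ¬ u < w → ∑< (μᴿ u) w ≈ 0#
    ∑<-μ-≮ {u} {w} u≮w = ∑-zero elems λ v → when-does-zero (v <? w) λ (v≤w , v≢w) →
      reflexive (≡.cong fromℤ (μ-≰ λ u≤v →
        u≮w (≤-trans u≤v v≤w , λ { ≡.refl → v≢w (antisym v≤w u≤v) })))

    ∑≤-μ : ∀ u w → ∑≤ (μᴿ u) w ≈ when (does (u ≟ w)) 1#
    ∑≤-μ u w with u ≟ w
    ... | yes ≡.refl = begin
      ∑≤ (μᴿ u) u            ≈⟨ ∑≤-split (μᴿ u) u ⟩
      μᴿ u u + ∑< (μᴿ u) u
        ≈⟨ +-cong (reflexive (≡.cong fromℤ (μ-diagonal u))) (∑<-μ-≮ (<-irrefl ≡.refl)) ⟩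
      (1# + 0#) + 0#         ≈⟨ ≈-trans (+-identityʳ _) (+-identityʳ _) ⟩
      1#                     ∎
    ... | no u≢w with u ≤? w
    ...   | yes u≤w = begin
      ∑≤ (μᴿ u) w            ≈⟨ ∑≤-split (μᴿ u) w ⟩
      μᴿ u w + ∑< (μᴿ u) w
        ≈⟨ +-cong (≈-trans (reflexive (≡.cong fromℤ (μ-< (u≤w , u≢w)))) (fromℤ-neg (μ-sum u w))) (∑<-μ u w) ⟩
      - fromℤ (μ-sum u w) + fromℤ (μ-sum u w)  ≈⟨ -‿inverseˡ _ ⟩
      0#                     ∎
    ...   | no u≰w = begin
      ∑≤ (μᴿ u) w            ≈⟨ ∑≤-split (μᴿ u) w ⟩
      μᴿ u w + ∑< (μᴿ u) w   ≈⟨ +-cong (reflexive (≡.cong fromℤ (μ-≰ u≰w))) (∑<-μ-≮ (u≰w ∘ proj₁)) ⟩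
      0# + 0#                ≈⟨ +-identityˡ 0# ⟩
      0#                     ∎

    -- The recursion for `μ` only provides `μ ζ = 1` in the incidence algebra, whereas passing from
    -- `h = g ζ` to `h μ = g` directly would use `ζ μ = 1`. Instead `(h μ) ζ = h = g ζ`, and `ζ` is
    -- cancelled by `∑≤-injective`.
    möbius-inversion : ∀ {g h} → (∀ w → ∑≤ g w ≈ h w) → ∀ w → ∑ elems (λ u → h u * μᴿ u w) ≈ g w
    möbius-inversion {g} {h} eq = ∑≤-injective λ w → begin
      ∑ elems (λ v → when (does (v ≤? w)) (∑ elems (λ u → h u * μᴿ u v)))
        ≈⟨ ∑-cong elems (λ v → when-∑ (does (v ≤? w)) elems _) ⟩
      ∑ elems (λ v → ∑ elems (λ u → when (does (v ≤? w)) (h u * μᴿ u v)))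
        ≈⟨ ∑-swap elems elems _ ⟩
      ∑ elems (λ u → ∑ elems (λ v → when (does (v ≤? w)) (h u * μᴿ u v)))
        ≈⟨ ∑-cong elems (λ u → ≈-trans (∑-when-*ˡ elems _ (h u) (μᴿ u)) (*-congˡ (∑≤-μ u w))) ⟩
      ∑ elems (λ u → h u * when (does (u ≟ w)) 1#)
        ≈⟨ ∑-cong elems (λ u → ≈-trans (≈-sym (when-*ˡ (does (u ≟ w)) (h u) 1#))
          (when-cong (does (u ≟ w)) (*-identityʳ (h u)))) ⟩
      ∑ elems (λ u → when (does (u ≟ w)) (h u))
        ≈⟨ ∑-≡ h unique (complete w) ⟩
      h w
        ≈⟨ eq w ⟨
      ∑≤ g w ∎

  -- Sums over codes

  open Triangle R using (_^_; ∑Tri; M)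

  ∑-subsets : ∀ m (f : Subset (suc m) → Carrier) →
    ∑ (subsets (suc m)) f ≈ ∑ (subsets m) (f ∘ (outside ∷_)) + ∑ (subsets m) (f ∘ (inside ∷_))
  ∑-subsets m f = ≈-trans (∑-++ (List.map (outside ∷_) (subsets m)) _ f)
    (+-cong (∑-map (outside ∷_) (subsets m) f) (∑-map (inside ∷_) (subsets m) f))

  ∑-map₃ : ∀ {A B C D : Set} (f : A → D) (g : B → D) (h : C → D) xs ys zs (k : D → Carrier) →
    ∑ (List.map f xs ++ List.map g ys ++ List.map h zs) k ≈ ∑ xs (k ∘ f) + (∑ ys (k ∘ g) + ∑ zs (k ∘ h))
  ∑-map₃ f g h xs ys zs k = ≈-trans (∑-++ (List.map f xs) _ k)
    (+-cong (∑-map f xs k) (≈-trans (∑-++ (List.map g ys) _ k) (+-cong (∑-map g ys k) (∑-map h zs k))))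

  ∑-pointeds : ∀ m (f : Pointed (suc m) → Carrier) →
    ∑ (pointeds (suc m)) f ≈
      ∑ (subsets m) (f ∘ here) + (∑ (pointeds m) (f ∘ there outside) + ∑ (pointeds m)
        (f ∘ there inside))
  ∑-pointeds m = ∑-map₃ here (there outside) (there inside) (subsets m) (pointeds m) (pointeds m)

  ∑-codes : ∀ m (f : Code m → Carrier) →
    ∑ (codes m) f ≈ ∑ (subsets m) (f ∘ none) + (∑ (subsets m) (f ∘ first) + ∑ (pointeds m) (f ∘ later))
  ∑-codes m = ∑-map₃ none first later (subsets m) (subsets m) (pointeds m)

  ∑Tri-decode : ∀ m (f : Tri (suc m) → Carrier) → ∑Tri (suc m) f ≈ ∑ (codes m) (f ∘ decode)
  ∑Tri-decode m f = ≈-trans (∑-↭ f (triwords↭codes m)) (∑-map decode (codes m) f)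

  -- The solution of the lower sum equations

  -- n is − p, kept as a variable so that the identities below hold in every commutative semiring.
  module LowerSums (q p n : Carrier) (1+p≈q : 1# + p ≈ q) (p+n≈0 : p + n ≈ 0#) where

    x+px≈qx : ∀ x → x + p * x ≈ q * x
    x+px≈qx x = ≈-trans (+-congʳ (≈-sym (*-identityˡ x)))
      (≈-trans (≈-sym (distribʳ x 1# p)) (*-congʳ 1+p≈q))

    -- p^∣A∣ (p − t), where t is the length of the initial run of elements of A.
    gSubset : ∀ {m} → Subset m → Carrier
    gSubset []            = p
    gSubset (outside ∷ A) = p * p ^ ∣ A ∣
    gSubset (inside  ∷ A) = p * gSubset A + n * p ^ ∣ A ∣

    gPointed : ∀ {m} → Pointed m → Carrier
    gPointed (here A)          = gSubset A
    gPointed (there outside P) = gPointed P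
    gPointed (there inside P)  = p * gPointed P

    g : ∀ {m} → Code m → Carrier
    g (none A)  = p ^ ∣ A ∣
    g (first A) = gSubset A
    g (later P) = gPointed P

    -- The sum of g over the codes first A below first B; kSubset is the one over the codes later P.
    hSubset : ∀ {m} → Subset m → Carrier
    hSubset []            = p
    hSubset (outside ∷ B) = p * q ^ ∣ B ∣
    hSubset (inside  ∷ B) = p * hSubset B

    within : ∀ {m} → Subset m → (Subset m → Carrier) → Carrier
    within {m} B f = ∑ (subsets m) (λ A → when (does (A Subset.⊆? B)) (f A))

    within-outside : ∀ {m} (B : Subset m) f → within (outside ∷ B) f ≈ within B (f ∘ (outside ∷_))
    within-outside {m} B f = ≈-trans (∑-subsets m _)
      (≈-trans (+-congˡ (∑-zero (subsets m) (λ _ → ≈-refl))) (+-identityʳ _))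

    within-inside : ∀ {m} (B : Subset m) f →
      within (inside ∷ B) f ≈ within B (f ∘ (outside ∷_)) + within B (f ∘ (inside ∷_))
    within-inside {m} B f = ∑-subsets m _

    within-* : ∀ {m} (B : Subset m) a f → within B (λ A → a * f A) ≈ a * within B f
    within-* {m} B a f = ∑-when-*ˡ (subsets m) (λ A → does (A Subset.⊆? B)) a f

    within-+ : ∀ {m} (B : Subset m) f h → within B (λ A → f A + h A) ≈ within B f + within B h
    within-+ {m} B f h = ≈-trans (∑-cong (subsets m) (λ A → when-+ (does (A Subset.⊆? B)) (f A) (h A)))
      (∑-+ (subsets m) _ _)

    within-power : ∀ {m} (B : Subset m) → within B (λ A → p ^ ∣ A ∣) ≈ q ^ ∣ B ∣
    within-power []            = +-identityʳ 1#
    within-power (outside ∷ B) = ≈-trans (within-outside B _) (within-power B)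
    within-power (inside  ∷ B) = begin
      within (inside ∷ B) (λ A → p ^ ∣ A ∣)        ≈⟨ within-inside B _ ⟩
      within B (λ A → p ^ ∣ A ∣) + within B (λ A → p * p ^ ∣ A ∣)
        ≈⟨ +-cong (within-power B) (≈-trans (within-* B p _) (*-congˡ (within-power B))) ⟩
      q ^ ∣ B ∣ + p * q ^ ∣ B ∣
        ≈⟨ x+px≈qx (q ^ ∣ B ∣) ⟩
      q * q ^ ∣ B ∣                                ∎

    -- When `B` contains the first position, the sets without it contribute `p * Q`. This cancels
    -- against the correction terms `n * Q` of the sets that contain it, and only `p * H` is left.
    within-gSubset : ∀ {m} (B : Subset m) → within B gSubset ≈ hSubset B
    within-gSubset []            = +-identityʳ p
    within-gSubset (outside ∷ B) =
      ≈-trans (within-outside B _) (≈-trans (within-* B p _) (*-congˡ (within-power B)))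
    within-gSubset (inside  ∷ B) = begin
      within (inside ∷ B) gSubset
        ≈⟨ within-inside B _ ⟩
      within B (λ A → p * p ^ ∣ A ∣) + within B (λ A → p * gSubset A + n * p ^ ∣ A ∣)
        ≈⟨ +-cong (≈-trans (within-* B p _) (*-congˡ (within-power B)))
             (≈-trans (within-+ B _ _) (+-cong
               (≈-trans (within-* B p _) (*-congˡ (within-gSubset B)))
               (≈-trans (within-* B n _) (*-congˡ (within-power B))))) ⟩
      p * Q + (p * H + n * Q)
        ≈⟨ solve 4 (λ p n Q H → p :* Q :+ (p :* H :+ n :* Q) := (p :+ n) :* Q :+ p :* H) ≈-refl p n Q
          H ⟩
      (p + n) * Q + p * H
        ≈⟨ +-congʳ (≈-trans (*-congʳ p+n≈0) (zeroˡ Q)) ⟩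
      0# + p * H
        ≈⟨ +-identityˡ _ ⟩
      p * H ∎
      where
      Q = q ^ ∣ B ∣
      H = hSubset B

    -- `belowFirst B P` and `belowPointed Q P` are what `does` of `codeLe?` computes to for
    -- `later P` below `first B` and below `later Q`.
    belowFirst : ∀ {m} → Subset m → Pointed m → Bool
    belowFirst B P = does (subsetStair? B (point P)) ∧ does (support P Subset.⊆? B)

    belowPointed : ∀ {m} → Pointed m → Pointed m → Bool
    belowPointed Q P = does (pointedStair? Q (point P)) ∧ does (support P Subset.⊆? support Q)

    kSubset : ∀ {m} → Subset m → Carrier
    kSubset {m} B = ∑ (pointeds m) (λ P → when (belowFirst B P) (gPointed P))

    -- If the last 1 is followed by a 2, then in a smaller word the last 1 stays in front of that
    -- place, moves onto it, or lies further right behind a 1 or a 2 there: these are the terms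
    -- `p * H`, `H`, `K` and `p * K`. If a 0 follows, no stair leads past it and `kSubset` vanishes.
    h+k : ∀ {m} (B : Subset m) → hSubset B + kSubset B ≈ p * q ^ ∣ B ∣
    h+k [] = ≈-trans (+-identityʳ p) (≈-sym (*-identityʳ p))
    h+k {suc m} (outside ∷ B) = ≈-trans (+-congˡ (∑-zero (pointeds (suc m)) (λ _ → ≈-refl)))
      (+-identityʳ _)
    h+k {suc m} (inside  ∷ B) = begin
      p * H + kSubset (inside ∷ B)
        ≈⟨ +-congˡ (≈-trans (∑-pointeds m _) (+-cong (within-gSubset B)
             (+-congˡ (∑-when-*ˡ (pointeds m) (belowFirst B) p gPointed)))) ⟩
      p * H + (H + (K + p * K))
        ≈⟨ solve 3 (λ p H K → p :* H :+ (H :+ (K :+ p :* K)) := (H :+ K) :+ p :* (H :+ K)) ≈-refl p H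
          K ⟩
      (H + K) + p * (H + K)
        ≈⟨ x+px≈qx (H + K) ⟩
      q * (H + K)
        ≈⟨ *-congˡ (h+k B) ⟩
      q * (p * Q)
        ≈⟨ solve 3 (λ q p Q → q :* (p :* Q) := p :* (q :* Q)) ≈-refl q p Q ⟩
      p * (q * Q) ∎
      where
      Q = q ^ ∣ B ∣
      H = hSubset B
      K = kSubset B

    ∧-false : ∀ b x → when (b ∧ false) x ≈ 0#
    ∧-false b x = reflexive (≡.cong (λ c → when c x) (∧-zeroʳ b))

    -- A smaller word cannot have its last 1 to the left of that of `Q`, so there only the `there`
    -- cases survive, and each 2 of `Q` contributes `1 + p = q`. From the last 1 of `Q` on, the
    -- count is that of `h+k`.
    below-pointed : ∀ {m} (Q : Pointed m) →
      ∑ (pointeds m) (λ P → when (belowPointed Q P) (gPointed P)) ≈ p * q ^ ∣ support Q ∣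
    below-pointed {suc m} (here B) = begin
      ∑ (pointeds (suc m)) _
        ≈⟨ ∑-pointeds m _ ⟩
      within B gSubset + (kSubset B + ∑ (pointeds m) _)
        ≈⟨ +-cong (within-gSubset B) (≈-trans
             (+-congˡ (∑-zero (pointeds m) (λ P →
               ∧-false (does (subsetStair? B (point P))) (p * gPointed P)))) (+-identityʳ _)) ⟩
      hSubset B + kSubset B
        ≈⟨ h+k B ⟩
      p * q ^ ∣ B ∣ ∎
    below-pointed {suc m} (there outside Q) = begin
      ∑ (pointeds (suc m)) _
        ≈⟨ ∑-pointeds m _ ⟩
      ∑ (subsets m) _ + (∑ (pointeds m) (λ P → when (belowPointed Q P) (gPointed P)) + ∑ (pointeds m) _)
        ≈⟨ +-cong (∑-zero (subsets m) (λ _ → ≈-refl)) (+-cong (below-pointed Q)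
             (∑-zero (pointeds m) (λ P → ∧-false (does (pointedStair? Q (point P)))
               (p * gPointed P)))) ⟩
      0# + (p * q ^ ∣ support Q ∣ + 0#)
        ≈⟨ ≈-trans (+-identityˡ _) (+-identityʳ _) ⟩
      p * q ^ ∣ support Q ∣ ∎
    below-pointed {suc m} (there inside Q) = begin
      ∑ (pointeds (suc m)) _
        ≈⟨ ∑-pointeds m _ ⟩
      ∑ (subsets m) _ + (∑ (pointeds m) (λ P → when (belowPointed Q P) (gPointed P))
        + ∑ (pointeds m) (λ P → when (belowPointed Q P) (p * gPointed P)))
        ≈⟨ +-cong (∑-zero (subsets m) (λ _ → ≈-refl)) (+-cong (below-pointed Q)
             (≈-trans (∑-when-*ˡ (pointeds m) (belowPointed Q) p gPointed)
               (*-congˡ (below-pointed Q)))) ⟩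
      0# + (p * X + p * (p * X))
        ≈⟨ ≈-trans (+-identityˡ _) (≈-sym (distribˡ p X (p * X))) ⟩
      p * (X + p * X)
        ≈⟨ *-congˡ (x+px≈qx X) ⟩
      p * (q * X) ∎
      where X = q ^ ∣ support Q ∣

    -- The words without 1 below `d` form a Boolean lattice and contribute `Q`. If `d` has a 1, the
    -- words with a 1 below it contribute `p * Q`, and `Q + p * Q = q * Q` accounts for the step
    -- joinand of `d`.
    below-code : ∀ {m} (d : Code m) → ∑ (codes m) (λ c → when (does (codeLe? c d)) (g c)) ≈ q ^ size d
    below-code {m} (none B) = begin
      ∑ (codes m) _
        ≈⟨ ∑-codes m _ ⟩
      within B (λ A → p ^ ∣ A ∣) + (∑ (subsets m) _ + ∑ (pointeds m) _)
        ≈⟨ +-cong (within-power B) (+-cong (∑-zero (subsets m) (λ _ → ≈-refl))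
          (∑-zero (pointeds m) (λ _ → ≈-refl))) ⟩
      q ^ ∣ B ∣ + (0# + 0#)
        ≈⟨ ≈-trans (+-congˡ (+-identityˡ 0#)) (+-identityʳ _) ⟩
      q ^ ∣ B ∣ ∎
    below-code {m} (first B) = begin
      ∑ (codes m) _
        ≈⟨ ∑-codes m _ ⟩
      within B (λ A → p ^ ∣ A ∣) + (within B gSubset + kSubset B)
        ≈⟨ +-cong (within-power B) (≈-trans (+-congʳ (within-gSubset B)) (h+k B)) ⟩
      Q + p * Q
        ≈⟨ x+px≈qx Q ⟩
      q * Q ∎
      where Q = q ^ ∣ B ∣
    below-code {m} (later P) = begin
      ∑ (codes m) _
        ≈⟨ ∑-codes m _ ⟩
      within (support P) (λ A → p ^ ∣ A ∣)
        + (∑ (subsets m) _ + ∑ (pointeds m) (λ P′ → when (belowPointed P P′) (gPointed P′)))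
        ≈⟨ +-cong (within-power (support P))
          (+-cong (∑-zero (subsets m) (λ _ → ≈-refl)) (below-pointed P)) ⟩
      Q + (0# + p * Q)
        ≈⟨ +-congˡ (+-identityˡ _) ⟩
      Q + p * Q
        ≈⟨ x+px≈qx Q ⟩
      q * Q ∎
      where Q = q ^ ∣ support P ∣

    module _ (m : ℕ) where
      open Inversion (Tri-finite (suc m)) (Hoch.⊑-isDecPartialOrder (suc m))
      open CLO (suc m) using (rank)

      lower-sum : ∀ w → ∑≤ (g ∘ encode) w ≈ q ^ rank w
      lower-sum w = begin
        ∑≤ (g ∘ encode) w
          ≈⟨ ∑Tri-decode m _ ⟩
        ∑ (codes m) (λ c → when (does (Hoch._⊑?_ (suc m) (decode c) w)) (g (encode (decode c))))
          ≈⟨ ∑-cong (codes m) (λ c → reflexive (≡.cong₂ when (le c) (≡.cong g (encode-decode c)))) ⟩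
        ∑ (codes m) (λ c → when (does (codeLe? c (encode w))) (g c))
          ≈⟨ below-code (encode w) ⟩
        q ^ size (encode w)
          ≡⟨ ≡.cong (q ^_) (≡.trans (≡.sym (rank-decode (encode w))) (≡.cong rank (decode-encode w))) ⟩
        q ^ rank w ∎
        where
        le : ∀ c → does (Hoch._⊑?_ (suc m) (decode c) w) ≡ does (codeLe? c (encode w))
        le c = ≡.trans (≡.cong (λ v → does (Hoch._⊑?_ (suc m) (decode c) v)) (≡.sym (decode-encode w)))
          (does-⇔ (⊑⇔CodeLe c (encode w)) (Hoch._⊑?_ (suc m) (decode c) (decode (encode w)))
            (codeLe? c (encode w)))

      -- Summing over `u` first, with `v` fixed, is the Möbius inversion of `lower-sum`: the values
      -- of `μ` drop out and only the solution `g` remains.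
      M-codes : ∀ r → M (suc m) q r ≈ ∑ (codes m) (λ c → r ^ size c * g c)
      M-codes r = begin
        ∑Tri (suc m) (λ u → ∑Tri (suc m) (λ v → μᴿ u v * q ^ rank u * r ^ rank v))
          ≈⟨ ∑-swap triwords triwords _ ⟩
        ∑Tri (suc m) (λ v → ∑Tri (suc m) (λ u → μᴿ u v * q ^ rank u * r ^ rank v))
          ≈⟨ ∑-cong triwords (λ v → ≈-trans (∑-cong triwords (λ u →
               solve 3 (λ a b c → a :* b :* c := c :* (b :* a)) ≈-refl (μᴿ u v) (q ^ rank u)
                 (r ^ rank v)))
               (∑-*ˡ triwords (r ^ rank v) _)) ⟩
        ∑Tri (suc m) (λ v → r ^ rank v * ∑Tri (suc m) (λ u → q ^ rank u * μᴿ u v))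
          ≈⟨ ∑-cong triwords (λ v → *-congˡ (möbius-inversion lower-sum v)) ⟩
        ∑Tri (suc m) (λ v → r ^ rank v * g (encode v))
          ≈⟨ ∑Tri-decode m _ ⟩
        ∑ (codes m) (λ c → r ^ rank (decode c) * g (encode (decode c)))
          ≈⟨ ∑-cong (codes m) (λ c → reflexive
            (≡.cong₂ (λ k d → r ^ k * g d) (rank-decode c) (encode-decode c))) ⟩
        ∑ (codes m) (λ c → r ^ size c * g c) ∎
        where triwords = Finite.elems (Tri-finite (suc m))

  -- Evaluation of both sides

  module Evaluation (x y y⁻¹ d⁻¹ : Carrier)
    (y⁻¹y≈1 : y⁻¹ * y ≈ 1#) (d⁻¹d≈1 : d⁻¹ * (y - x) ≈ 1#) where

    -- `q` and `r` are the arguments at which `M` is taken. `p` is `q - 1`, since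
    -- `(y + 1) - (y - x) = x + 1`, and `n` is its negative.
    d p n q r σ : Carrier
    d = y - x
    p = (x + 1#) * d⁻¹
    n = - (x + 1#) * d⁻¹
    q = (y + 1#) * d⁻¹
    r = d * y⁻¹
    σ = x + (y + 1#)

    d+x≈y : d + x ≈ y
    d+x≈y = ≈-trans (+-assoc y (- x) x) (≈-trans (+-congˡ (-‿inverseˡ x)) (+-identityʳ y))

    1+p≈q : 1# + p ≈ q
    1+p≈q = begin
      1# + p                        ≈⟨ +-congʳ d⁻¹d≈1 ⟨
      d⁻¹ * d + (x + 1#) * d⁻¹
        ≈⟨ solve 4 (λ i d x o → i :* d :+ (x :+ o) :* i := ((d :+ x) :+ o) :* i) ≈-refl d⁻¹ d x 1# ⟩
      (d + x + 1#) * d⁻¹            ≈⟨ *-congʳ (+-congʳ d+x≈y) ⟩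
      q                             ∎

    p+n≈0 : p + n ≈ 0#
    p+n≈0 = ≈-trans (≈-sym (distribʳ d⁻¹ _ _)) (≈-trans (*-congʳ (-‿inverseʳ (x + 1#))) (zeroˡ d⁻¹))

    yr≈d : y * r ≈ d
    yr≈d = begin
      y * (d * y⁻¹)  ≈⟨ solve 3 (λ y d j → y :* (d :* j) := (j :* y) :* d) ≈-refl y d y⁻¹ ⟩
      y⁻¹ * y * d    ≈⟨ *-congʳ y⁻¹y≈1 ⟩
      1# * d         ≈⟨ *-identityˡ d ⟩
      d              ∎

    yr-cancel : ∀ a → y * (r * (a * d⁻¹)) ≈ a
    yr-cancel a = begin
      y * (r * (a * d⁻¹))
        ≈⟨ solve 4 (λ y r a i → y :* (r :* (a :* i)) := (y :* r) :* i :* a) ≈-refl y r a d⁻¹ ⟩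
      y * r * d⁻¹ * a      ≈⟨ *-congʳ (≈-trans (*-congʳ yr≈d) (≈-trans (*-comm d d⁻¹) d⁻¹d≈1)) ⟩
      1# * a               ≈⟨ *-identityˡ a ⟩
      a                    ∎

    -- The summands are the weights of one letter once `y ^ suc m` is distributed over the
    -- positions: `y` for a letter other than 2, and `y * (r * p) = x + 1` for a 2. This is where
    -- the denominators disappear.
    y+yrp≈σ : y + y * (r * p) ≈ σ
    y+yrp≈σ = ≈-trans (+-congˡ (yr-cancel (x + 1#)))
      (solve 3 (λ x y o → y :+ (x :+ o) := x :+ (y :+ o)) ≈-refl x y 1#)

    open LowerSums q p n 1+p≈q p+n≈0

    -- y * y ^ m * (T m + r * (G m + P m)) is the left-hand side and X m its part from words with a 1.
    T G P D V X : ℕ → Carrier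
    T m = ∑ (subsets m) (λ A → r ^ ∣ A ∣ * p ^ ∣ A ∣)
    G m = ∑ (subsets m) (λ A → r ^ ∣ A ∣ * gSubset A)
    P m = ∑ (pointeds m) (λ Q → r ^ ∣ support Q ∣ * gPointed Q)
    D m = ∑ (subsets m) (λ A → x ^ (m ∸ ∣ A ∣) * (y + 1#) ^ ∣ A ∣)
    V m = ∑ (pointeds m) (λ Q → x ^ (m ∸ ∣ support Q ∣) * (y + 1#) ^ ∣ support Q ∣)
    X m = y ^ m * (y * r * (G m + P m))

    scaled : ∀ {A : Set} xs a {f h : A → Carrier} → (∀ z → f z ≈ a * h z) → ∑ xs f ≈ a * ∑ xs h
    scaled xs a eq = ≈-trans (∑-cong xs eq) (∑-*ˡ xs a _)

    T-suc : ∀ m → T (suc m) ≈ T m + r * p * T m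
    T-suc m = ≈-trans (∑-subsets m _) (+-congˡ (scaled (subsets m) (r * p) λ A →
      solve 4 (λ r R p P → r :* R :* (p :* P) := r :* p :* (R :* P)) ≈-refl r (r ^ ∣ A ∣) p
        (p ^ ∣ A ∣)))

    G-suc : ∀ m → G (suc m) ≈ p * T m + (r * p * G m + r * n * T m)
    G-suc m = ≈-trans (∑-subsets m _) (+-cong
      (scaled (subsets m) p λ A →
        solve 3 (λ R p P → R :* (p :* P) := p :* (R :* P)) ≈-refl (r ^ ∣ A ∣) p (p ^ ∣ A ∣))
      (begin
        ∑ (subsets m) (λ A → r * r ^ ∣ A ∣ * (p * gSubset A + n * p ^ ∣ A ∣))
          ≈⟨ ∑-cong (subsets m) (λ A →
               solve 6 (λ r R p g n P → r :* R :* (p :* g :+ n :* P) := r :* p :* (R :* g) :+ r :* n :*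
                 (R :* P))
                 ≈-refl r (r ^ ∣ A ∣) p (gSubset A) n (p ^ ∣ A ∣)) ⟩
        ∑ (subsets m) (λ A → r * p * (r ^ ∣ A ∣ * gSubset A) + r * n * (r ^ ∣ A ∣ * p ^ ∣ A ∣))
          ≈⟨ ∑-+ (subsets m) _ _ ⟩
        ∑ (subsets m) (λ A → r * p * (r ^ ∣ A ∣ * gSubset A)) + ∑ (subsets m) (λ A →
          r * n * (r ^ ∣ A ∣ * p ^ ∣ A ∣))
          ≈⟨ +-cong (∑-*ˡ (subsets m) (r * p) _) (∑-*ˡ (subsets m) (r * n) _) ⟩
        r * p * G m + r * n * T m ∎))

    P-suc : ∀ m → P (suc m) ≈ G m + (P m + r * p * P m)
    P-suc m = ≈-trans (∑-pointeds m _) (+-congˡ (+-congˡ (scaled (pointeds m) (r * p) λ Q →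
      solve 4 (λ r R p g → r :* R :* (p :* g) := r :* p :* (R :* g)) ≈-refl r (r ^ ∣ support Q ∣) p
        (gPointed Q))))

    x^-suc : ∀ {k m} → k ℕ.≤ m → ∀ z → x ^ (suc m ∸ k) * z ≈ x * (x ^ (m ∸ k) * z)
    x^-suc {k} {m} k≤m z = ≈-trans (*-congʳ (reflexive (≡.cong (x ^_) (ℕ.+-∸-assoc 1 k≤m))))
      (*-assoc x _ z)

    z-out : ∀ a z b → a * (z * b) ≈ z * (a * b)
    z-out = solve 3 (λ a z b → a :* (z :* b) := z :* (a :* b)) ≈-refl

    D≈σ^ : ∀ m → D m ≈ σ ^ m
    D≈σ^ zero    = ≈-trans (+-identityʳ _) (*-identityʳ 1#)
    D≈σ^ (suc m) = begin
      D (suc m)                    ≈⟨ ∑-subsets m _ ⟩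
      ∑ (subsets m) _ + ∑ (subsets m) _
        ≈⟨ +-cong (scaled (subsets m) x (λ A → x^-suc (Subset.∣p∣≤n A) _))
                  (scaled (subsets m) (y + 1#) (λ A → z-out _ _ _)) ⟩
      x * D m + (y + 1#) * D m     ≈⟨ distribʳ (D m) x (y + 1#) ⟨
      σ * D m                      ≈⟨ *-congˡ (D≈σ^ m) ⟩
      σ * σ ^ m                    ∎

    -- The marked position is outside the support and counts as a factor `x`; the subset behind it
    -- gives `σ ^ m`. Unrolled, `V m` is `m x` times the power of `σ` with exponent `m - 1`, and 0
    -- for `m = 0`.
    V-suc : ∀ m → V (suc m) ≈ x * σ ^ m + σ * V m
    V-suc m = begin
      V (suc m)                                  ≈⟨ ∑-pointeds m _ ⟩
      ∑ (subsets m) _ + (∑ (pointeds m) _ + ∑ (pointeds m) _)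
        ≈⟨ +-cong (scaled (subsets m) x (λ A → x^-suc (Subset.∣p∣≤n A) _))
             (+-cong (scaled (pointeds m) x (λ Q → x^-suc (Subset.∣p∣≤n (support Q)) _))
                     (scaled (pointeds m) (y + 1#) (λ Q → z-out _ _ _))) ⟩
      x * D m + (x * V m + (y + 1#) * V m)
        ≈⟨ +-cong (*-congˡ (D≈σ^ m)) (≈-sym (distribʳ (V m) x (y + 1#))) ⟩
      x * σ ^ m + σ * V m                        ∎

    y^T≈σ^ : ∀ m → y ^ m * T m ≈ σ ^ m
    y^T≈σ^ zero    = ≈-trans (*-identityˡ _) (≈-trans (+-identityʳ _) (*-identityʳ 1#))
    y^T≈σ^ (suc m) = begin
      y * y ^ m * T (suc m)                  ≈⟨ *-congˡ (T-suc m) ⟩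
      y * y ^ m * (T m + r * p * T m)
        ≈⟨ solve 4 (λ y Y s T → y :* Y :* (T :+ s :* T) := (y :+ y :* s) :* (Y :* T)) ≈-refl y (y ^ m)
          (r * p) (T m) ⟩
      (y + y * (r * p)) * (y ^ m * T m)      ≈⟨ *-cong y+yrp≈σ (y^T≈σ^ m) ⟩
      σ * σ ^ m                              ∎

    X-suc : ∀ m → X (suc m) ≈ σ * X m + x * (x + 1#) * σ ^ m
    X-suc m = begin
      y * y ^ m * (y * r * (G (suc m) + P (suc m)))
        ≈⟨ *-congˡ (*-congˡ (+-cong (G-suc m) (P-suc m))) ⟩
      y * y ^ m * (y * r * ((p * T m + (r * p * G m + r * n * T m)) + (G m + (P m + r * p * P m))))
        ≈⟨ solve 8 (λ y Y r p n T G P →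
             y :* Y :* (y :* r :* ((p :* T :+ (r :* p :* G :+ r :* n :* T)) :+
               (G :+ (P :+ r :* p :* P)))) :=
             (y :+ y :* (r :* p)) :* (Y :* (y :* r :* (G :+ P)))
               :+ (y :* (y :* (r :* p)) :+ y :* r :* (y :* (r :* n))) :* (Y :* T))
             ≈-refl y (y ^ m) r p n (T m) (G m) (P m) ⟩
      (y + y * (r * p)) * X m + (y * (y * (r * p)) + y * r * (y * (r * n))) * (y ^ m * T m)
        ≈⟨ +-cong (*-congʳ y+yrp≈σ) (*-cong coefficient (y^T≈σ^ m)) ⟩
      σ * X m + x * (x + 1#) * σ ^ m ∎
      where
      -- The first summand stems from `p * T m` in `G-suc`, where a 0 follows the last 1; the second
      -- is the correction `n` for a 2 in that place. Together they are `(y - d) * (x + 1)`, and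
      -- `y - d` is `x`.
      coefficient : y * (y * (r * p)) + y * r * (y * (r * n)) ≈ x * (x + 1#)
      coefficient = begin
        y * (y * (r * p)) + y * r * (y * (r * n))
          ≈⟨ +-cong (*-cong (≈-sym d+x≈y) (yr-cancel (x + 1#))) (*-cong yr≈d (yr-cancel (- (x + 1#)))) ⟩
        (d + x) * (x + 1#) + d * - (x + 1#)
          ≈⟨ solve 4 (λ d x a b → (d :+ x) :* a :+ d :* b := x :* a :+ d :* (a :+ b)) ≈-refl d x
            (x + 1#) (- (x + 1#)) ⟩
        x * (x + 1#) + d * ((x + 1#) + - (x + 1#))
          ≈⟨ +-congˡ (≈-trans (*-congˡ (-‿inverseʳ (x + 1#))) (zeroʳ d)) ⟩
        x * (x + 1#) + 0#
          ≈⟨ +-identityʳ _ ⟩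
        x * (x + 1#) ∎

    -- Both sides start with `σ` at `m = 0` and satisfy `S (suc m) = σ * S m + x * (x + 1) * σ ^
    -- m`, the left one by `X-suc` and the right one by `V-suc`.
    y^M≈V : ∀ m → y * σ ^ m + X m ≈ σ * σ ^ m + (x + 1#) * V m
    y^M≈V zero = begin
      y * 1# + 1# * (y * r * (1# * p + 0# + 0#))
        ≈⟨ +-cong (*-identityʳ y) (≈-trans (*-identityˡ _) (≈-trans (*-congˡ
             (≈-trans (+-identityʳ _) (≈-trans (+-identityʳ _) (*-identityˡ p)))) (*-assoc y r p))) ⟩
      y + y * (r * p)
        ≈⟨ y+yrp≈σ ⟩
      σ
        ≈⟨ ≈-trans (+-cong (*-identityʳ σ) (zeroʳ (x + 1#))) (+-identityʳ σ) ⟨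
      σ * 1# + (x + 1#) * 0# ∎
    y^M≈V (suc m) = begin
      y * (σ * σ ^ m) + X (suc m)
        ≈⟨ +-congˡ (X-suc m) ⟩
      y * (σ * σ ^ m) + (σ * X m + x * (x + 1#) * σ ^ m)
        ≈⟨ solve 6 (λ y s S X x a → y :* (s :* S) :+ (s :* X :+ x :* a :* S) := s :*
          (y :* S :+ X) :+ x :* a :* S)
             ≈-refl y σ (σ ^ m) (X m) x (x + 1#) ⟩
      σ * (y * σ ^ m + X m) + x * (x + 1#) * σ ^ m
        ≈⟨ +-congʳ (*-congˡ (y^M≈V m)) ⟩
      σ * (σ * σ ^ m + (x + 1#) * V m) + x * (x + 1#) * σ ^ m
        ≈⟨ solve 5 (λ s S a V x → s :* (s :* S :+ a :* V) :+ x :* a :* S := s :* (s :* S) :+ a :*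
          (x :* S :+ s :* V))
             ≈-refl σ (σ ^ m) (x + 1#) (V m) x ⟩
      σ * (σ * σ ^ m) + (x + 1#) * (x * σ ^ m + σ * V m)
        ≈⟨ +-congˡ (*-congˡ (V-suc m)) ⟨
      σ * (σ * σ ^ m) + (x + 1#) * V (suc m) ∎

    F-codes : ∀ m → y ^ suc m * M (suc m) q r ≈ y * σ ^ m + X m
    F-codes m = begin
      y * y ^ m * M (suc m) q r
        ≈⟨ *-congˡ (≈-trans (M-codes m r) (∑-codes m _)) ⟩
      y * y ^ m * (T m + (∑ (subsets m) _ + ∑ (pointeds m) _))
        ≈⟨ *-congˡ (+-congˡ (+-cong (scaled (subsets m) r (λ A → *-assoc r _ _))
             (scaled (pointeds m) r (λ Q → *-assoc r _ _)))) ⟩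
      y * y ^ m * (T m + (r * G m + r * P m))
        ≈⟨ solve 6 (λ y Y r T G P → y :* Y :* (T :+ (r :* G :+ r :* P)) := y :* (Y :* T) :+ Y :*
          (y :* r :* (G :+ P)))
             ≈-refl y (y ^ m) r (T m) (G m) (P m) ⟩
      y * (y ^ m * T m) + X m
        ≈⟨ +-congʳ (*-congˡ (y^T≈σ^ m)) ⟩
      y * σ ^ m + X m ∎

    term : ℕ → ℕ → ℕ → Carrier
    term m k a = x ^ (suc m ∸ k) * (x + 1#) ^ (k ∸ a) * (y + 1#) ^ a

    -- The factor taken out here and in the next two lemmas records the step joinand: `x` if there
    -- is none, `y + 1` if it is an atom, `x + 1` if it is not. What remains is the common summand
    -- of `D` and `V`.
    term-none : ∀ {m} (A : Subset m) → term m ∣ A ∣ ∣ A ∣ ≈ x * (x ^ (m ∸ ∣ A ∣) * (y + 1#) ^ ∣ A ∣)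
    term-none {m} A = begin
      term m ∣ A ∣ ∣ A ∣
        ≡⟨ ≡.cong (λ k → x ^ (suc m ∸ ∣ A ∣) * (x + 1#) ^ k * (y + 1#) ^ ∣ A ∣) (ℕ.n∸n≡0 ∣ A ∣) ⟩
      x ^ (suc m ∸ ∣ A ∣) * 1# * (y + 1#) ^ ∣ A ∣
        ≈⟨ *-congʳ (*-identityʳ _) ⟩
      x ^ (suc m ∸ ∣ A ∣) * (y + 1#) ^ ∣ A ∣
        ≈⟨ x^-suc (Subset.∣p∣≤n A) _ ⟩
      x * (x ^ (m ∸ ∣ A ∣) * (y + 1#) ^ ∣ A ∣) ∎

    term-first : ∀ {m} (A : Subset m) →
      term m (suc ∣ A ∣) (suc ∣ A ∣) ≈ (y + 1#) * (x ^ (m ∸ ∣ A ∣) * (y + 1#) ^ ∣ A ∣)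
    term-first {m} A = begin
      term m (suc ∣ A ∣) (suc ∣ A ∣)
        ≡⟨ ≡.cong (λ k → x ^ (m ∸ ∣ A ∣) * (x + 1#) ^ k * ((y + 1#) * (y + 1#) ^ ∣ A ∣))
          (ℕ.n∸n≡0 ∣ A ∣) ⟩
      x ^ (m ∸ ∣ A ∣) * 1# * ((y + 1#) * (y + 1#) ^ ∣ A ∣)
        ≈⟨ *-congʳ (*-identityʳ _) ⟩
      x ^ (m ∸ ∣ A ∣) * ((y + 1#) * (y + 1#) ^ ∣ A ∣)
        ≈⟨ z-out _ _ _ ⟩
      (y + 1#) * (x ^ (m ∸ ∣ A ∣) * (y + 1#) ^ ∣ A ∣) ∎

    term-later : ∀ {m} (A : Subset m) →
      term m (suc ∣ A ∣) ∣ A ∣ ≈ (x + 1#) * (x ^ (m ∸ ∣ A ∣) * (y + 1#) ^ ∣ A ∣)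
    term-later {m} A = begin
      term m (suc ∣ A ∣) ∣ A ∣
        ≡⟨ ≡.cong (λ k → x ^ (m ∸ ∣ A ∣) * (x + 1#) ^ k * (y + 1#) ^ ∣ A ∣) (ℕ.m+n∸n≡m 1 ∣ A ∣) ⟩
      x ^ (m ∸ ∣ A ∣) * ((x + 1#) * 1#) * (y + 1#) ^ ∣ A ∣
        ≈⟨ *-congʳ (*-congˡ (*-identityʳ _)) ⟩
      x ^ (m ∸ ∣ A ∣) * (x + 1#) * (y + 1#) ^ ∣ A ∣
        ≈⟨ solve 3 (λ a b c → a :* b :* c := b :* (a :* c)) ≈-refl _ _ _ ⟩
      (x + 1#) * (x ^ (m ∸ ∣ A ∣) * (y + 1#) ^ ∣ A ∣) ∎

    right-side : ∀ m → ∑Tri (suc m) (λ u → term m (∣Can∣ u) (neg u)) ≈ σ * σ ^ m + (x + 1#) * V m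
    right-side m = begin
      ∑Tri (suc m) (λ u → term m (∣Can∣ u) (neg u))
        ≈⟨ ∑Tri-decode m _ ⟩
      ∑ (codes m) (λ c → term m (∣Can∣ (decode c)) (neg (decode c)))
        ≈⟨ ∑-cong (codes m) (λ c → reflexive (≡.cong₂ (term m) (∣Can∣-decode c) (neg-decode c))) ⟩
      ∑ (codes m) (λ c → term m (size c) (atoms c))
        ≈⟨ ∑-codes m _ ⟩
      ∑ (subsets m) _ + (∑ (subsets m) _ + ∑ (pointeds m) _)
        ≈⟨ +-cong (scaled (subsets m) x term-none) (+-cong (scaled (subsets m) (y + 1#) term-first)
             (scaled (pointeds m) (x + 1#) (λ Q → term-later (support Q)))) ⟩
      x * D m + ((y + 1#) * D m + (x + 1#) * V m)
        ≈⟨ ≈-trans (≈-sym (+-assoc _ _ _)) (+-congʳ (≈-sym (distribʳ (D m) x (y + 1#)))) ⟩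
      σ * D m + (x + 1#) * V m
        ≈⟨ +-congʳ (*-congˡ (D≈σ^ m)) ⟩
      σ * σ ^ m + (x + 1#) * V m ∎

proposition6p11 :
  ∀ (n : ℕ) → n > 0 →
  ∀ {c ℓ} (R : CommutativeRing c ℓ) →
  let open CommutativeRing R
      open Triangle R in
  ∀ (x y : Carrier) (y-inv : Invertible _≈_ 1# _*_ y) (y-x-inv : Invertible _≈_ 1# _*_ (y - x)) →
  F n x y y-inv y-x-inv
    ≈ ∑Tri n (λ u → x ^ (n ∸ ∣Can∣ u) * (x + 1#) ^ (∣Can∣ u ∸ neg u) * (y + 1#) ^ neg u)
proposition6p11 (suc m) _ R x y (y⁻¹ , y⁻¹y≈1 , _) (d⁻¹ , d⁻¹d≈1 , _) =
  ≈-trans (F-codes m) (≈-trans (y^M≈V m) (≈-sym (right-side m)))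
  where
  open CommutativeRing R using () renaming (trans to ≈-trans; sym to ≈-sym)
  open Sums.Evaluation R x y y⁻¹ d⁻¹ y⁻¹y≈1 d⁻¹d≈1
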